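{- Let $n \geqslant 3$ and $k$ be integers of the same parity with $\lfloor n/2 \rfloor \leqslant k \leqslant n-3$. Then $rn_k(C_n) = \mathrm{LB}(n,k)$, where, with $\varPhi(n,k) = \left\lceil \frac{3k+3-n}{2} \right\rceil$, $$\mathrm{LB}(n,k) = \begin{cases} \varPhi(n,k)\left(\frac{n-2}{2}\right) + k - \frac{n}{2} + 1 & \text{if } n \text{ is even},\\ \varPhi(n,k)\left(\frac{n-1}{2}\right) & \text{if } n \text{ is odd}.\end{cases}$$
   Context: $C_n$ is the cycle on vertex set $\mathbb{Z}_n$, with $u,v$ adjacent iff $u \equiv v \pm 1 \pmod n$; $d(u,v)$ is the graph distance. A radio-$k$-labeling of a graph $G$ is a function $f \colon V(G) \to \{0,1,2,\ldots\}$ with $|f(u)-f(v)| \geqslant k - d(u,v) + 1$ for all distinct $u,v$. The span of $f$ is $\max\{|f(u)-f(v)|\}$, and $rn_k(G)$ is the minimum span over all radio-$k$-labelings of $G$. -}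

module Defs where

open import Data.Nat using (ℕ; zero; suc; _+_; _*_; _∸_; _≤_; _<_; _≥_)
open import Data.Nat.DivMod using (_/_; _%_)
open import Data.Nat.Properties using (_≟_)
open import Data.Nat using (_⊓_; ∣_-_∣)
open import Data.Fin using (Fin; toℕ)
open import Data.Product using (Σ; _×_; ∃; ∃-syntax)
open import Relation.Binary.PropositionalEquality using (_≡_)
open import Relation.Nullary using (¬_)

cycleDist : (n : ℕ) → Fin n → Fin n → ℕ
cycleDist n u v = ∣ toℕ u - toℕ v ∣ ⊓ (n ∸ ∣ toℕ u - toℕ v ∣)

-- radio-k-labeling of C_n: |f u - f v| ≥ k - d(u,v) + 1 for distinct u,v
-- (written without truncated subtraction as |f u - f v| + d(u,v) ≥ k + 1).
IsRadioLabeling : (n k : ℕ) → (Fin n → ℕ) → Set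
IsRadioLabeling n k f =
  ∀ (u v : Fin n) → ¬ (u ≡ v) → ∣ f u - f v ∣ + cycleDist n u v ≥ k + 1

IsSpan : (n : ℕ) → (Fin n → ℕ) → ℕ → Set
IsSpan n f s = (∀ (u v : Fin n) → ∣ f u - f v ∣ ≤ s) × (∃[ u ] ∃[ v ] ∣ f u - f v ∣ ≡ s)

IsRadioNumber : (n k r : ℕ) → Set
IsRadioNumber n k r =
  (∃[ f ] IsRadioLabeling n k f × IsSpan n f r)
  × (∀ (f : Fin n → ℕ) (s : ℕ) → IsRadioLabeling n k f → IsSpan n f s → r ≤ s)

⌈_/2⌉ : ℕ → ℕ
⌈ a /2⌉ = (a + 1) / 2

-- Φ(n,k) = ⌈(3k+3-n)/2⌉ (here 3k+3 ≥ n under the hypotheses)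
Φ : ℕ → ℕ → ℕ
Φ n k = ⌈ (3 * k + 3) ∸ n /2⌉

LB : ℕ → ℕ → ℕ
LB n k with n % 2
... | zero = Φ n k * ((n ∸ 2) / 2) + (k ∸ (n / 2)) + 1
... | suc _ = Φ n k * ((n ∸ 1) / 2)

{-# OPTIONS --safe #-}

-- Any three vertices of C_n have pairwise distances summing to at most n, so a
-- window of Φ consecutive labels contains at most two labels.  Splitting the
-- labels into such windows, starting from the least one, gives the lower bound.
--
-- For the upper bound put e = (n - k - 2) / 2, so that Φ + e = k + 1 and
-- n = Φ + 3 e + 1.  List the vertices in the order P 0, Q 0, P 1, Q 1, … with
-- P i labelled i Φ.  Then P steps by e or e + 1 around the cycle and Q i is
-- almost antipodal to P i; only pairs at most three places apart need a check.
-- Stepping by e runs through a coset of the subgroup generated by e (in ℤ_n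
-- for odd n, in ℤ_{n/2} for even n); one step of e + 1 moves to the next
-- coset.  For even n, Q i is the antipode of P i.  For odd n, P and Q share
-- one coset, last for P and first for Q; if e is even, Q has to jump over the
-- part of that coset used by P, which costs an extra e / 2 in its labels.
module Submission where

open import Defs
open import Data.Nat
open import Data.Nat.Coprimality as Coprimality
  using (Coprime; coprime-/gcd; coprime-Bézout; coprime-divisor)
open import Data.Nat.Divisibility using (_∣_; divides; n∣m*n; ∣m+n∣m⇒∣n; ∣⇒≤)
open import Data.Nat.DivMod
open import Data.Nat.GCD using (gcd; gcd[m,n]∣m; gcd[m,n]∣n; gcd[m,n]≢0; module Bézout)
open import Data.Nat.Properties
open import Data.Nat.Tactic.RingSolver using (solve-∀; solve)
open import Data.Fin as Fin using (Fin; toℕ; fromℕ<; splitAt; join; punchOut)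
open import Data.Fin.Properties as Fin
  using (toℕ<n; toℕ-fromℕ<; toℕ-injective; join-splitAt; splitAt-join; any?; punchOut-injective)
open import Data.List using (List; []; _∷_; length; filter; allFin)
open import Data.List.Extrema ≤-totalOrder using (argmin; f[argmin]≤f[xs])
open import Data.List.Properties using (length-tabulate)
open import Data.List.Relation.Unary.All as All using (All)
open import Data.List.Relation.Unary.All.Properties as All using (all-filter)
open import Data.List.Relation.Unary.AllPairs as AllPairs using ()
open import Data.List.Relation.Unary.Unique.Propositional using (Unique)
open import Data.List.Relation.Unary.Unique.Propositional.Properties as Unique using (allFin⁺)
open import Data.Product using (_×_; _,_; ∃-syntax; proj₁; proj₂)
open import Data.Sum using (_⊎_; inj₁; inj₂; [_,_]′)
open import Function using (_∘_; id)
open import Relation.Binary.Definitions using (tri<; tri≈; tri>)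
open import Relation.Binary.PropositionalEquality hiding ([_])
open import Relation.Nullary using (¬_; Dec; yes; no; contradiction; ¬?)
open import Relation.Unary using (Decidable)

-- The lower bound

-- Every linear inequality is a semiring identity from a sum of known inequalities and the slack s.
linear : ∀ {l r a b} s → a ≤ b → l + b + s ≡ r + a → l ≤ r
linear {l} {r} {a} {b} s a≤b eq = +-cancelʳ-≤ b l r (begin
  l + b      ≤⟨ m≤m+n (l + b) s ⟩
  l + b + s  ≡⟨ eq ⟩
  r + a      ≤⟨ +-monoʳ-≤ r a≤b ⟩
  r + b      ∎)
  where open ≤-Reasoning

slack : ∀ {l r} s → l + s ≡ r → l ≤ r
slack {l} s eq = subst (l ≤_) eq (m≤m+n l s)

-- The two adjacent transpositions generate all orders of three numbers; a sorted triple is its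
-- least element followed by two gaps.
wlog-sorted₃ : (P : ℕ → ℕ → ℕ → Set) →
  (∀ {a b c} → P a b c → P b a c) → (∀ {a b c} → P a b c → P a c b) →
  (∀ a p q → P a (a + p) (a + p + q)) → ∀ a b c → P a b c
wlog-sorted₃ P swap₁ swap₂ base = all
  where
  sorted : ∀ {a b c} → a ≤ b → b ≤ c → P a b c
  sorted {a} {b} {c} a≤b b≤c = subst₂ (P a) (m+[n∸m]≡n a≤b)
    (trans (cong (_+ (c ∸ b)) (m+[n∸m]≡n a≤b)) (m+[n∸m]≡n b≤c)) (base a (b ∸ a) (c ∸ b))

  all : ∀ a b c → P a b c
  all a b c with ≤-total a b | ≤-total b c | ≤-total a c
  ... | inj₁ a≤b | inj₁ b≤c | _        = sorted a≤b b≤c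
  ... | inj₁ a≤b | inj₂ c≤b | inj₁ a≤c = swap₂ (sorted a≤c c≤b)
  ... | inj₁ a≤b | inj₂ c≤b | inj₂ c≤a = swap₂ (swap₁ (sorted c≤a a≤b))
  ... | inj₂ b≤a | inj₁ b≤c | inj₁ a≤c = swap₁ (sorted b≤a a≤c)
  ... | inj₂ b≤a | inj₁ b≤c | inj₂ c≤a = swap₁ (swap₂ (sorted b≤c c≤a))
  ... | inj₂ b≤a | inj₂ c≤b | _        = swap₁ (swap₂ (swap₁ (sorted c≤b b≤a)))

perimeter : (ℕ → ℕ → ℕ) → ℕ → ℕ → ℕ → ℕ
perimeter d a b c = d a b + d b c + d a c

module _ (d : ℕ → ℕ → ℕ) (d-comm : ∀ a b → d a b ≡ d b a) where

  perimeter-swap₁ : ∀ a b c → perimeter d a b c ≡ perimeter d b a c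
  perimeter-swap₁ a b c rewrite d-comm b a =
    trans (+-assoc (d a b) _ _) (trans (cong (d a b +_) (+-comm (d b c) _)) (sym (+-assoc (d a b) _ _)))

  perimeter-swap₂ : ∀ a b c → perimeter d a b c ≡ perimeter d a c b
  perimeter-swap₂ a b c rewrite d-comm c b =
    trans (+-assoc (d a b) _ _) (trans (+-comm (d a b) _) (cong (_+ d a b) (+-comm (d b c) _)))

arc : ℕ → ℕ → ℕ → ℕ
arc n a b = ∣ a - b ∣ ⊓ (n ∸ ∣ a - b ∣)

arc-comm : ∀ n a b → arc n a b ≡ arc n b a
arc-comm n a b rewrite ∣-∣-comm a b = refl

-- For a sorted triple, bound the two inner distances by the gaps p and q, and the outer one by the
-- complementary arc n - (p + q). Together these arcs go around the cycle once.
perimeter-arc≤n : ∀ n a b c → a ≤ n → b ≤ n → c ≤ n → perimeter (arc n) a b c ≤ n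
perimeter-arc≤n n = wlog-sorted₃ _
  (λ {a} {b} {c} h b≤ a≤ c≤ → subst (_≤ n) (perimeter-swap₁ (arc n) (arc-comm n) a b c) (h a≤ b≤ c≤))
  (λ {a} {b} {c} h a≤ c≤ b≤ → subst (_≤ n) (perimeter-swap₂ (arc n) (arc-comm n) a b c) (h a≤ b≤ c≤))
  base
  where
  open ≤-Reasoning
  base : ∀ a p q → a ≤ n → a + p ≤ n → a + p + q ≤ n → perimeter (arc n) a (a + p) (a + p + q) ≤ n
  base a p q _ _ c≤n = begin
    perimeter (arc n) a (a + p) (a + p + q)
      ≤⟨ +-mono-≤ (+-mono-≤ (m⊓n≤m ∣ a - a + p ∣ _) (m⊓n≤m ∣ a + p - a + p + q ∣ _))
                  (m⊓n≤n ∣ a - a + p + q ∣ _) ⟩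
    ∣ a - a + p ∣ + ∣ a + p - a + p + q ∣ + (n ∸ ∣ a - a + p + q ∣)
      ≡⟨ cong₂ _+_ (cong₂ _+_ (∣m-m+n∣≡n a p) (∣m-m+n∣≡n (a + p) q))
           (cong (n ∸_) (trans (cong (∣ a -_∣) (+-assoc a p q)) (∣m-m+n∣≡n a (p + q)))) ⟩
    p + q + (n ∸ (p + q))
      ≡⟨ m+[n∸m]≡n (≤-trans (m≤n+m (p + q) a) (subst (_≤ n) (+-assoc a p q) c≤n)) ⟩
    n ∎

-- On a line the largest of the three differences is the sum of the other two, so the perimeter is
-- twice the largest.
perimeter-∣-∣≤ : ∀ w a b c → ∣ a - b ∣ ≤ w → ∣ b - c ∣ ≤ w → ∣ a - c ∣ ≤ w →
  perimeter ∣_-_∣ a b c ≤ w + w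
perimeter-∣-∣≤ w = wlog-sorted₃ _
  (λ {a} {b} {c} h ba ac bc → subst (_≤ w + w) (perimeter-swap₁ ∣_-_∣ ∣-∣-comm a b c)
     (h (subst (_≤ w) (∣-∣-comm b a) ba) bc ac))
  (λ {a} {b} {c} h ac cb ab → subst (_≤ w + w) (perimeter-swap₂ ∣_-_∣ ∣-∣-comm a b c)
     (h ab (subst (_≤ w) (∣-∣-comm c b) cb) ac))
  base
  where
  base : ∀ a p q → ∣ a - a + p ∣ ≤ w → ∣ a + p - a + p + q ∣ ≤ w → ∣ a - a + p + q ∣ ≤ w →
    perimeter ∣_-_∣ a (a + p) (a + p + q) ≤ w + w
  base a p q _ _ ac rewrite +-assoc a p q | ∣m+n-m+o∣≡∣n-o∣ a p (p + q)
    | ∣m-m+n∣≡n a p | ∣m-m+n∣≡n p q | ∣m-m+n∣≡n a (p + q) = +-mono-≤ ac ac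

length-filter-¬ : ∀ {a p} {A : Set a} {P : A → Set p} (P? : Decidable P) (xs : List A) →
  length (filter P? xs) + length (filter (λ x → ¬? (P? x)) xs) ≡ length xs
length-filter-¬ P? [] = refl
length-filter-¬ P? (x ∷ xs) with P? x
... | yes _ = cong suc (length-filter-¬ P? xs)
... | no  _ = trans (+-suc _ _) (cong suc (length-filter-¬ P? xs))

∣-∣≤-window : ∀ {c w x y} → c ≤ x → c ≤ y → x ≤ c + w → y ≤ c + w → ∣ x - y ∣ ≤ w
∣-∣≤-window {c} {w} {x} {y} c≤x c≤y x≤ y≤ with ≤-total x y
... | inj₁ x≤y = subst (_≤ w) (sym (m≤n⇒∣m-n∣≡n∸m x≤y))
  (≤-trans (∸-mono y≤ c≤x) (≤-reflexive (m+n∸m≡n c w)))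
... | inj₂ y≤x = subst (_≤ w) (sym (m≤n⇒∣n-m∣≡n∸m y≤x))
  (≤-trans (∸-mono x≤ c≤y) (≤-reflexive (m+n∸m≡n c w)))

cycleDist-+≤n : ∀ n (u v : Fin n) → cycleDist n u v + cycleDist n u v ≤ n
cycleDist-+≤n n u v = ≤-trans (+-mono-≤ (m⊓n≤m d (n ∸ d)) (m⊓n≤n d (n ∸ d)))
  (≤-reflexive (m+[n∸m]≡n d≤n))
  where
  d : ℕ
  d = ∣ toℕ u - toℕ v ∣
  d≤n : d ≤ n
  d≤n = ≤-trans (∣m-n∣≤m⊔n (toℕ u) (toℕ v)) (⊔-lub (<⇒≤ (toℕ<n u)) (<⇒≤ (toℕ<n v)))

module Counting {n k : ℕ} {f : Fin n → ℕ} (radio : IsRadioLabeling n k f)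
                {w : ℕ} (narrow : w + w + n < 3 * (k + 1)) where

  -- Adding the radio conditions of three vertices gives 3 (k + 1) on one side; the label
  -- differences contribute at most 2 w and the distances at most n, against `narrow`.
  length≤2 : ∀ {c} (xs : List (Fin n)) → Unique xs →
    All (λ x → c ≤ f x) xs → All (λ x → f x < c + suc w) xs → length xs ≤ 2
  length≤2 [] _ _ _ = z≤n
  length≤2 (_ ∷ []) _ _ _ = s≤s z≤n
  length≤2 (_ ∷ _ ∷ []) _ _ _ = s≤s (s≤s z≤n)
  length≤2 {c} (u ∷ v ∷ t ∷ _) ((u≢v All.∷ u≢t All.∷ _) AllPairs.∷ (v≢t All.∷ _) AllPairs.∷ _)
    (cu All.∷ cv All.∷ ct All.∷ _) (uc All.∷ vc All.∷ tc All.∷ _) = contradiction narrow (≤⇒≯ bound)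
    where
    below : ∀ {x} → x < c + suc w → x ≤ c + w
    below {x} h = s≤s⁻¹ (subst (x <_) (+-suc c w) h)
    labels : perimeter ∣_-_∣ (f u) (f v) (f t) ≤ w + w
    labels = perimeter-∣-∣≤ w (f u) (f v) (f t)
      (∣-∣≤-window cu cv (below uc) (below vc))
      (∣-∣≤-window cv ct (below vc) (below tc))
      (∣-∣≤-window cu ct (below uc) (below tc))
    distances : perimeter (arc n) (toℕ u) (toℕ v) (toℕ t) ≤ n
    distances = perimeter-arc≤n n (toℕ u) (toℕ v) (toℕ t)
      (<⇒≤ (toℕ<n u)) (<⇒≤ (toℕ<n v)) (<⇒≤ (toℕ<n t))
    regroup : ∀ a b c x y z → a + x + (b + y) + (c + z) ≡ a + b + c + (x + y + z)
    regroup = solve-∀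
    triple : ∀ x → x + x + x ≡ 3 * x
    triple = solve-∀
    open ≤-Reasoning
    bound : 3 * (k + 1) ≤ w + w + n
    bound = begin
      3 * (k + 1)                  ≡⟨ triple (k + 1) ⟨
      k + 1 + (k + 1) + (k + 1)    ≤⟨ +-mono-≤ (+-mono-≤ (radio u v u≢v) (radio v t v≢t)) (radio u t u≢t) ⟩
      ∣ f u - f v ∣ + cycleDist n u v + (∣ f v - f t ∣ + cycleDist n v t) + (∣ f u - f t ∣ + cycleDist n u t)
        ≡⟨ regroup ∣ f u - f v ∣ ∣ f v - f t ∣ ∣ f u - f t ∣ (cycleDist n u v) (cycleDist n v t) (cycleDist n u t) ⟩
      perimeter ∣_-_∣ (f u) (f v) (f t) + perimeter (arc n) (toℕ u) (toℕ v) (toℕ t)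
                                   ≤⟨ +-mono-≤ labels distances ⟩
      w + w + n                    ∎

  -- Each window removes at most two vertices and raises the floor of the remaining labels by
  -- `suc w`; the induction continues from the new floor.
  above : ∀ q r {c} (xs : List (Fin n)) → Unique xs → All (λ x → c ≤ f x) xs →
    q + q + r ≤ length xs →
    ∃[ ys ] Unique ys × All (λ y → c + q * suc w ≤ f y) ys × r ≤ length ys
  above zero r {c} xs xs! c≤xs len =
    xs , xs! , All.map (λ {x} → subst (_≤ f x) (sym (+-identityʳ c))) c≤xs , len
  above (suc q) r {c} xs xs! c≤xs len =
    let ys , ys! , c≤ys , r≤ = above q r high (Unique.filter⁺ high? xs!) (All.map ≮⇒≥ (all-filter high? xs)) len′
    in ys , ys! , All.map (λ {y} → subst (_≤ f y) (+-assoc c (suc w) (q * suc w))) c≤ys , r≤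
    where
    low? : Decidable (λ x → f x < c + suc w)
    low? x = f x <? c + suc w
    high? : Decidable (λ x → ¬ (f x < c + suc w))
    high? x = ¬? (low? x)
    high : List (Fin n)
    high = filter high? xs
    low≤2 : length (filter low? xs) ≤ 2
    low≤2 = length≤2 _ (Unique.filter⁺ low? xs!) (All.filter⁺ low? c≤xs) (all-filter low? xs)
    arrange : ∀ q r → 2 + (q + q + r) ≡ suc q + suc q + r
    arrange = solve-∀
    len′ : q + q + r ≤ length high
    len′ = +-cancelˡ-≤ 2 _ _ (begin
      2 + (q + q + r)                             ≡⟨ arrange q r ⟩
      suc q + suc q + r                           ≤⟨ len ⟩
      length xs                                   ≡⟨ length-filter-¬ low? xs ⟨
      length (filter low? xs) + length high       ≤⟨ +-monoˡ-≤ _ low≤2 ⟩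
      2 + length high                             ∎)
      where open ≤-Reasoning

  least : Fin n → Fin n
  least u = argmin f u (allFin n)

  least≤ : ∀ u → All (λ v → f (least u) ≤ f v) (allFin n)
  least≤ u = f[argmin]≤f[xs] u (allFin n)

  far : ∀ {u v d s} → (∀ u v → ∣ f u - f v ∣ ≤ s) → f u + d ≤ f v → d ≤ s
  far {u} {v} {d} span h = ≤-trans (+-cancelˡ-≤ (f u) _ _ (≤-trans h (m≤n+∣n-m∣ (f v) (f u)))) (span u v)

  -- The m windows above the least label hold at most 2 m vertices, so one vertex lies above all of
  -- them.
  span-odd : ∀ {s} m → Fin n → n ≡ m + m + 1 → (∀ u v → ∣ f u - f v ∣ ≤ s) → suc w * m ≤ s
  span-odd m u n≡ span with above m 1 (allFin n) (allFin⁺ n) (least≤ u)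
      (≤-reflexive (trans (sym n≡) (sym (length-tabulate id))))
  ... | x ∷ _ , _ , x≥ All.∷ _ , _ = far span (subst (λ d → f (least u) + d ≤ f x) (*-comm m (suc w)) x≥)

  -- Two vertices lie above all m windows. Their distance is at most n / 2 = m + 1, so their labels
  -- differ by at least k - m, and the larger label is that much higher.
  span-even : ∀ {s} m → Fin n → n ≡ m + m + 2 → m < k → (∀ u v → ∣ f u - f v ∣ ≤ s) →
    suc w * m + (k ∸ suc m) + 1 ≤ s
  span-even {s} m u n≡ m<k span with above m 2 (allFin n) (allFin⁺ n) (least≤ u)
      (≤-reflexive (trans (sym n≡) (sym (length-tabulate id))))
  ... | _ ∷ [] , _ , _ , s≤s ()
  ... | x ∷ y ∷ _ , (x≢y All.∷ _) AllPairs.∷ _ , x≥ All.∷ y≥ All.∷ _ , _ = conclude (≤-total (f x) (f y))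
    where
    c : ℕ
    c = f (least u)
    half : cycleDist n x y ≤ suc m
    half with cycleDist n x y ≤? suc m
    ... | yes h = h
    ... | no h = contradiction (cycleDist-+≤n n x y)
      (<⇒≱ (≤-trans (≤-reflexive (trans (cong suc n≡) (arrange m))) (+-mono-≤ (≰⇒> h) (<⇒≤ (≰⇒> h)))))
      where
      arrange : ∀ m → 1 + (m + m + 2) ≡ 2 + m + (1 + m)
      arrange = solve-∀
    gap : k + 1 ∸ suc m ≤ ∣ f x - f y ∣
    gap = m≤n+o⇒m∸n≤o (k + 1) (suc m) (≤-trans (radio x y x≢y)
      (≤-trans (+-monoʳ-≤ ∣ f x - f y ∣ half) (≤-reflexive (+-comm _ (suc m)))))
    climb : ∀ {a b} → c + m * suc w ≤ a → a ≤ b → k + 1 ∸ suc m ≤ b ∸ a →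
      c + (suc w * m + (k ∸ suc m) + 1) ≤ b
    climb {a} {b} c≤a a≤b h = begin
      c + (suc w * m + (k ∸ suc m) + 1)  ≡⟨ arrange c (suc w) m (k ∸ suc m) ⟩
      c + m * suc w + (k ∸ suc m + 1)    ≡⟨ cong (c + m * suc w +_) (+-∸-comm 1 m<k) ⟨
      c + m * suc w + (k + 1 ∸ suc m)    ≤⟨ +-mono-≤ c≤a h ⟩
      a + (b ∸ a)                        ≡⟨ m+[n∸m]≡n a≤b ⟩
      b                                  ∎
      where
      open ≤-Reasoning
      arrange : ∀ c w m r → c + (w * m + r + 1) ≡ c + m * w + (r + 1)
      arrange = solve-∀
    conclude : f x ≤ f y ⊎ f y ≤ f x → suc w * m + (k ∸ suc m) + 1 ≤ s
    conclude (inj₁ x≤y) = far span (climb x≥ x≤y (subst (_ ≤_) (m≤n⇒∣m-n∣≡n∸m x≤y) gap))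
    conclude (inj₂ y≤x) = far span (climb y≥ y≤x (subst (_ ≤_) (m≤n⇒∣n-m∣≡n∸m y≤x) gap))

-- Separation of two labelled vertices

cycleDist-sym : ∀ n (u v : Fin n) → cycleDist n u v ≡ cycleDist n v u
cycleDist-sym n u v = cong (λ d → d ⊓ (n ∸ d)) (∣-∣-comm (toℕ u) (toℕ v))

toℕ-mod : ∀ a n .{{_ : NonZero n}} → toℕ (a mod n) ≡ a % n
toℕ-mod a n = toℕ-fromℕ< (m%n<n a n)

-- Since d ≤ n, moving d forward wraps around at most once. The residues then differ by d or by n -
-- d, and both give the same minimum.
cycleDist-mod : ∀ n .{{_ : NonZero n}} a d → d ≤ n →
  cycleDist n (a mod n) ((a + d) mod n) ≡ d ⊓ (n ∸ d)
cycleDist-mod n a d d≤n = trans (cong₂ (arc n) (toℕ-mod a n) (toℕ-mod (a + d) n)) main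
  where
  r : ℕ
  r = a % n
  r<n : r < n
  r<n = m%n<n a n
  shift : (a + d) % n ≡ (r + d) % n
  shift = begin
    (a + d) % n                  ≡⟨ cong (λ x → (x + d) % n) (m≡m%n+[m/n]*n a n) ⟩
    (r + (a / n) * n + d) % n    ≡⟨ cong (_% n) (swap r ((a / n) * n) d) ⟩
    (r + d + (a / n) * n) % n    ≡⟨ [m+kn]%n≡m%n (r + d) (a / n) n ⟩
    (r + d) % n                  ∎
    where
    open ≡-Reasoning
    swap : ∀ x y z → x + y + z ≡ x + z + y
    swap = solve-∀
  main : arc n r ((a + d) % n) ≡ d ⊓ (n ∸ d)
  main with r + d <? n
  ... | yes r+d<n = cong (λ x → x ⊓ (n ∸ x))
    (trans (cong (∣ r -_∣) (trans shift (m<n⇒m%n≡m r+d<n))) (∣m-m+n∣≡n r d))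
  ... | no r+d≮n = trans (cong (λ x → x ⊓ (n ∸ x)) gap)
    (trans (cong ((n ∸ d) ⊓_) (m∸[m∸n]≡n d≤n)) (⊓-comm (n ∸ d) d))
    where
    n≤r+d : n ≤ r + d
    n≤r+d = ≮⇒≥ r+d≮n
    s : ℕ
    s = r + d ∸ n
    s+n≡ : s + n ≡ r + d
    s+n≡ = m∸n+n≡m n≤r+d
    s<n : s < n
    s<n = +-cancelʳ-< n s n (subst (_< n + n) (sym s+n≡) (+-mono-<-≤ r<n d≤n))
    s+[n∸d]≡r : s + (n ∸ d) ≡ r
    s+[n∸d]≡r = +-cancelʳ-≡ d _ _ (trans (+-assoc s _ _) (trans (cong (s +_) (m∸n+n≡m d≤n)) s+n≡))
    gap : ∣ r - (a + d) % n ∣ ≡ n ∸ d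
    gap = begin
      ∣ r - (a + d) % n ∣   ≡⟨ cong (∣ r -_∣) (trans shift (trans (cong (_% n) (sym s+n≡)) (trans ([m+n]%n≡m%n s n) (m<n⇒m%n≡m s<n)))) ⟩
      ∣ r - s ∣             ≡⟨ cong (∣_- s ∣) (sym s+[n∸d]≡r) ⟩
      ∣ s + (n ∸ d) - s ∣   ≡⟨ ∣-∣-comm (s + (n ∸ d)) s ⟩
      ∣ s - s + (n ∸ d) ∣   ≡⟨ ∣m-m+n∣≡n s (n ∸ d) ⟩
      n ∸ d                 ∎
      where open ≡-Reasoning

-- The positions a and b are kept unreduced, so that checking a pair becomes linear arithmetic; K
-- will be k + 1.
Separated : (n : ℕ) .{{_ : NonZero n}} → ℕ → (a x b y : ℕ) → Set
Separated n K a x b y = K ≤ ∣ x - y ∣ + cycleDist n (a mod n) (b mod n)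

module _ {n : ℕ} .{{_ : NonZero n}} {K : ℕ} where

  separated-sym : ∀ a x b y → Separated n K a x b y → Separated n K b y a x
  separated-sym a x b y = subst (K ≤_)
    (cong₂ _+_ (∣-∣-comm x y) (cycleDist-sym n (a mod n) (b mod n)))

  separated-labels : ∀ {a x b y} → K + x ≤ y → Separated n K a x b y
  separated-labels {a} {x} {b} {y} h = ≤-trans
    (+-cancelʳ-≤ x K _ (≤-trans h (≤-trans (m≤n+∣n-m∣ y x) (≤-reflexive (+-comm x _)))))
    (m≤m+n ∣ x - y ∣ _)

  -- One inequality for each of the two arcs b - a and n - (b - a). The bound y ≤ x + ∣ x - y ∣
  -- holds for both orders of the labels.
  separated : ∀ {a x b y} → a ≤ b → b ≤ a + n →
    K + x + a ≤ y + b → K + x + b ≤ y + n + a → Separated n K a x b y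
  separated {a} {x} {b} {y} a≤b b≤a+n h₁ h₂ = begin
    K                                                    ≤⟨ ⊓-glb K≤₁ K≤₂ ⟩
    (∣ x - y ∣ + d) ⊓ (∣ x - y ∣ + (n ∸ d))              ≡⟨ +-distribˡ-⊓ ∣ x - y ∣ d (n ∸ d) ⟨
    ∣ x - y ∣ + d ⊓ (n ∸ d)                              ≡⟨ cong (∣ x - y ∣ +_) (cycleDist-mod n a d d≤n) ⟨
    ∣ x - y ∣ + cycleDist n (a mod n) ((a + d) mod n)    ≡⟨ cong (λ c → ∣ x - y ∣ + cycleDist n (a mod n) (c mod n)) a+d≡b ⟩
    ∣ x - y ∣ + cycleDist n (a mod n) (b mod n)          ∎
    where
    open ≤-Reasoning
    d : ℕ
    d = b ∸ a
    a+d≡b : a + d ≡ b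
    a+d≡b = m+[n∸m]≡n a≤b
    d≤n : d ≤ n
    d≤n = m≤n+o⇒m∸n≤o b a b≤a+n
    y≤ : y ≤ x + ∣ x - y ∣
    y≤ = m≤n+∣n-m∣ y x
    split₁ : ∀ K x a y d t → K + x + a ≤ y + (a + d) → y ≤ x + t → K ≤ t + d
    split₁ K x a y d t p q = linear 0 (+-mono-≤ p q) (solve (K ∷ x ∷ a ∷ y ∷ d ∷ t ∷ []))
    split₂ : ∀ K x a y d c t → K + x + (a + d) ≤ y + (d + c) + a → y ≤ x + t → K ≤ t + c
    split₂ K x a y d c t p q = linear 0 (+-mono-≤ p q) (solve (K ∷ x ∷ a ∷ y ∷ d ∷ c ∷ t ∷ []))
    K≤₁ : K ≤ ∣ x - y ∣ + d
    K≤₁ = split₁ K x a y d _ (subst (λ b → K + x + a ≤ y + b) (sym a+d≡b) h₁) y≤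
    K≤₂ : K ≤ ∣ x - y ∣ + (n ∸ d)
    K≤₂ = split₂ K x a y d (n ∸ d) _
      (subst₂ (λ b n → K + x + b ≤ y + n + a) (sym a+d≡b) (sym (m+[n∸m]≡n d≤n)) h₂) y≤

-- Pigeonhole: punching out a missed value would inject `Fin (suc n)` into `Fin n`.
injective⇒surjective : ∀ {n} {f : Fin n → Fin n} → (∀ {i j} → f i ≡ f j → i ≡ j) → ∀ v → ∃[ i ] f i ≡ v
injective⇒surjective {suc n} {f} inj v with any? (λ i → f i Fin.≟ v)
... | yes found = found
... | no none = contradiction
  (Fin.injective⇒≤ {f = λ i → punchOut (v≢f i)} (λ {i} {j} → inj ∘ punchOut-injective (v≢f i) (v≢f j)))
  1+n≰n
  where
  v≢f : ∀ i → v ≢ f i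
  v≢f i v≡fi = none (i , sym v≡fi)

-- The labels are given along an enumeration of the vertices; an injective enumeration is
-- invertible, and its inverse carries them to the vertices.
transport-labels : ∀ {n k s} (x : Fin n → Fin n) (ℓ : Fin n → ℕ) →
  (∀ {i j} → x i ≡ x j → i ≡ j) →
  (∀ i j → i ≢ j → k + 1 ≤ ∣ ℓ i - ℓ j ∣ + cycleDist n (x i) (x j)) →
  (∀ i → ℓ i ≤ s) → (∃[ i ] ℓ i ≡ 0) → (∃[ i ] ℓ i ≡ s) →
  ∃[ f ] IsRadioLabeling n k f × IsSpan n f s
transport-labels {n} {k} {s} x ℓ inj sep ℓ≤s (i₀ , ℓi₀≡0) (i₁ , ℓi₁≡s) =
  ℓ ∘ x⁻¹ , radio , span , x i₀ , x i₁ , attained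
  where
  x⁻¹ : Fin n → Fin n
  x⁻¹ v = proj₁ (injective⇒surjective inj v)
  xx⁻¹ : ∀ v → x (x⁻¹ v) ≡ v
  xx⁻¹ v = proj₂ (injective⇒surjective inj v)
  x⁻¹x : ∀ i → x⁻¹ (x i) ≡ i
  x⁻¹x i = inj (xx⁻¹ (x i))
  radio : IsRadioLabeling n k (ℓ ∘ x⁻¹)
  radio u v u≢v = subst₂ (λ a b → k + 1 ≤ ∣ ℓ (x⁻¹ u) - ℓ (x⁻¹ v) ∣ + cycleDist n a b) (xx⁻¹ u) (xx⁻¹ v)
    (sep (x⁻¹ u) (x⁻¹ v) (λ eq → u≢v (trans (sym (xx⁻¹ u)) (trans (cong x eq) (xx⁻¹ v)))))
  span : ∀ u v → ∣ ℓ (x⁻¹ u) - ℓ (x⁻¹ v) ∣ ≤ s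
  span u v = ≤-trans (∣m-n∣≤m⊔n (ℓ (x⁻¹ u)) _) (⊔-lub (ℓ≤s (x⁻¹ u)) (ℓ≤s (x⁻¹ v)))
  attained : ∣ ℓ (x⁻¹ (x i₀)) - ℓ (x⁻¹ (x i₁)) ∣ ≡ s
  attained rewrite x⁻¹x i₀ | x⁻¹x i₁ | ℓi₀≡0 = ℓi₁≡s

-- Inequalities for pairs of listed vertices

private
  -- x and l stand for i * e and i * φ, g for γ i; primes count index steps.
  module Arith {φ e : ℕ} (e+2≤φ : e + 2 ≤ φ) where

    -- The hypotheses of `separated` for K = φ + e and n = φ + 3 e + 1. In the names below, the
    -- digit is the difference of the two indices.
    Sep : (a x b y : ℕ) → Set
    Sep a x b y = (a ≤ b) × (b ≤ a + (φ + 3 * e + 1)) ×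
      (φ + e + x + a ≤ y + b) × (φ + e + x + b ≤ y + (φ + 3 * e + 1) + a)

    PP₁ : ∀ x l u u′ → u ≤ u′ → u′ ≤ 1 + u → Sep (x + u) l (e + x + u′) (φ + l)
    PP₁ x l u u′ p q =
      linear e p (solve (e ∷ x ∷ u ∷ u′ ∷ [])) ,
      linear (φ + 2 * e) q (solve (φ ∷ e ∷ x ∷ u ∷ u′ ∷ [])) ,
      linear 0 p (solve (φ ∷ e ∷ x ∷ l ∷ u ∷ u′ ∷ [])) ,
      linear (φ + e) q (solve (φ ∷ e ∷ x ∷ l ∷ u ∷ u′ ∷ []))

    QQ₁ : ∀ x l w w′ g g′ → w ≤ w′ → w′ ≤ 1 + w → g ≤ g′ → g′ + 1 ≤ φ →
      Sep (g + 2 * e + x + w) (l + g) (g′ + 2 * e + (e + x) + w′) (φ + l + g′)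
    QQ₁ x l w w′ g g′ p q r t =
      linear e (+-mono-≤ p r) (solve (e ∷ x ∷ w ∷ w′ ∷ g ∷ g′ ∷ [])) ,
      linear (2 * e + 1 + g) (+-mono-≤ q t) (solve (φ ∷ e ∷ x ∷ w ∷ w′ ∷ g ∷ g′ ∷ [])) ,
      linear 0 (+-mono-≤ p (+-mono-≤ r r)) (solve (φ ∷ e ∷ x ∷ l ∷ w ∷ w′ ∷ g ∷ g′ ∷ [])) ,
      linear (φ + e) q (solve (φ ∷ e ∷ x ∷ l ∷ w ∷ w′ ∷ g ∷ g′ ∷ []))

    -- The offset g occurs in both position and label of `Q`: it counts twice along the forward arc,
    -- which gives the last hypothesis, and cancels along the backward one, which gives `w ≤ 1 + u`.
    PQ₀ : ∀ x l u w g → u ≤ w → w ≤ 1 + u → g + 1 ≤ φ → φ + u ≤ g + g + e + w →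
      Sep (x + u) l (g + 2 * e + x + w) (l + g)
    PQ₀ x l u w g p q r t =
      linear (g + 2 * e) p (solve (e ∷ x ∷ u ∷ w ∷ g ∷ [])) ,
      linear (e + 1) (+-mono-≤ q r) (solve (φ ∷ e ∷ x ∷ u ∷ w ∷ g ∷ [])) ,
      linear 0 t (solve (φ ∷ e ∷ x ∷ l ∷ u ∷ w ∷ g ∷ [])) ,
      linear 0 q (solve (φ ∷ e ∷ x ∷ l ∷ u ∷ w ∷ g ∷ []))

    -- `P` has the smaller position but the larger label, so the labels are attached crosswise here.
    -- The arc around the back is what requires `g + g ≤ φ + e`.
    QP₁ : ∀ x l u′ w g → u′ ≤ w → w ≤ 1 + u′ → g + 1 ≤ φ → g + g ≤ φ + e →
      Sep (e + x + u′) (l + g) (g + 2 * e + x + w) (φ + l)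
    QP₁ x l u′ w g p q r t =
      linear (g + e) p (solve (e ∷ x ∷ u′ ∷ w ∷ g ∷ [])) ,
      linear (2 * e + 1) (+-mono-≤ q r) (solve (φ ∷ e ∷ x ∷ u′ ∷ w ∷ g ∷ [])) ,
      linear 0 p (solve (φ ∷ e ∷ x ∷ l ∷ u′ ∷ w ∷ g ∷ [])) ,
      linear 0 (+-mono-≤ q t) (solve (φ ∷ e ∷ x ∷ l ∷ u′ ∷ w ∷ g ∷ []))

    PQ₁ : ∀ x l u w′ g′ → u ≤ w′ → w′ ≤ 2 + u → g′ + 1 ≤ φ →
      Sep (x + u) l (g′ + 2 * e + (e + x) + w′) (φ + l + g′)
    PQ₁ x l u w′ g′ p q r =
      linear (g′ + 3 * e) p (solve (e ∷ x ∷ u ∷ w′ ∷ g′ ∷ [])) ,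
      linear 0 (+-mono-≤ q r) (solve (φ ∷ e ∷ x ∷ u ∷ w′ ∷ g′ ∷ [])) ,
      linear (2 * g′ + 2 * e) p (solve (φ ∷ e ∷ x ∷ l ∷ u ∷ w′ ∷ g′ ∷ [])) ,
      linear 1 (+-mono-≤ q e+2≤φ) (solve (φ ∷ e ∷ x ∷ l ∷ u ∷ w′ ∷ g′ ∷ []))

    -- Two steps of `P` make up the offset 2 e of `Q`, leaving `P` only g + w - u″ behind; the label
    -- difference 2 φ - g compensates, as g cancels.
    QP₂ : ∀ x l u″ w g → u″ ≤ w → w ≤ 1 + u″ → g + 1 ≤ φ → g + g ≤ φ + e →
      Sep (e + (e + x) + u″) (l + g) (g + 2 * e + x + w) (φ + (φ + l))
    QP₂ x l u″ w g p q r t =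
      linear g p (solve (e ∷ x ∷ u″ ∷ w ∷ g ∷ [])) ,
      linear (3 * e + 1) (+-mono-≤ q r) (solve (φ ∷ e ∷ x ∷ u″ ∷ w ∷ g ∷ [])) ,
      linear 2 (+-mono-≤ p e+2≤φ) (solve (φ ∷ e ∷ x ∷ l ∷ u″ ∷ w ∷ g ∷ [])) ,
      linear (φ + e) (+-mono-≤ q t) (solve (φ ∷ e ∷ x ∷ l ∷ u″ ∷ w ∷ g ∷ []))

    -- Two index steps raise the label by 2 φ ≥ φ + e + 2, so positions no longer matter.
    labels₂ : ∀ l l′ → φ + (φ + l) ≤ l′ → φ + e + l ≤ l′
    labels₂ l l′ p = linear 2 (+-mono-≤ p e+2≤φ) (solve (φ ∷ e ∷ l ∷ l′ ∷ []))

    labels₃ : ∀ l l′ g → g + 1 ≤ φ → φ + (φ + (φ + l)) ≤ l′ → φ + e + (l + g) ≤ l′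
    labels₃ l l′ g r p = linear 3 (+-mono-≤ r (+-mono-≤ p e+2≤φ)) (solve (φ ∷ e ∷ l ∷ l′ ∷ g ∷ []))

    g+1≤φ : ∀ g → g + g ≤ φ + e → g + 1 ≤ φ
    g+1≤φ g t = *-cancelˡ-≤ 2 (linear 0 (+-mono-≤ t e+2≤φ) (solve (φ ∷ e ∷ g ∷ [])))

step⇒mono : ∀ {f : ℕ → ℕ} → (∀ i → f i ≤ f (suc i)) → ∀ {i j} → i ≤ j → f i ≤ f j
step⇒mono step {zero} {zero} _ = ≤-refl
step⇒mono step {zero} {suc j} _ = ≤-trans (step⇒mono step {zero} {j} z≤n) (step j)
step⇒mono {f} step {suc i} {suc j} (s≤s i≤j) = step⇒mono {f ∘ suc} (step ∘ suc) i≤j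

-- P i and Q i are natural numbers read modulo n, with labels ℓP i and ℓQ i.
record Profile (e φ : ℕ) : Set where
  field
    e+2≤φ : e + 2 ≤ φ
    u w γ : ℕ → ℕ
    u-step : ∀ i → u i ≤ u (1 + i)
    u-jump : ∀ i → u (1 + i) ≤ 1 + u i
    w-step : ∀ i → w i ≤ w (1 + i)
    w-jump : ∀ i → w (1 + i) ≤ 1 + w i
    γ-step : ∀ i → γ i ≤ γ (1 + i)
    u₂≤w   : ∀ i → u (2 + i) ≤ w i
    w≤1+u  : ∀ i → w i ≤ 1 + u i
    γ-low  : ∀ i → φ + u i ≤ γ i + γ i + e + w i
    γ-high : ∀ i → γ i + γ i ≤ φ + e

  P Q ℓP ℓQ : ℕ → ℕ
  P i = i * e + u i
  Q i = γ i + 2 * e + i * e + w i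
  ℓP i = i * φ
  ℓQ i = i * φ + γ i

module Spacing {e φ n : ℕ} (profile : Profile e φ) .{{_ : NonZero n}} (n≡ : n ≡ φ + 3 * e + 1) where
  open Profile profile
  open Arith {φ} {e} e+2≤φ

  private
    fromArith : ∀ {a x b y} → Sep a x b y → Separated n (φ + e) a x b y
    fromArith {a} {x} {b} {y} (p , q , r , t) = separated p
      (subst (λ n → b ≤ a + n) (sym n≡) q) r
      (subst (λ n → φ + e + x + b ≤ y + n + a) (sym n≡) t)

    -- For the pairs in which the larger label sits at the smaller position.
    fromArithʳ : ∀ {a x b y} → Sep a x b y → Separated n (φ + e) b x a y
    fromArithʳ {a} {x} {b} {y} s = subst (λ d → φ + e ≤ ∣ x - y ∣ + d)
      (cycleDist-sym n (a mod n) (b mod n)) (fromArith s)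

    γ+1≤φ : ∀ i → γ i + 1 ≤ φ
    γ+1≤φ i = g+1≤φ (γ i) (γ-high i)

    u₁≤w : ∀ i → u (1 + i) ≤ w i
    u₁≤w i = ≤-trans (u-step (1 + i)) (u₂≤w i)

    u≤w : ∀ i → u i ≤ w i
    u≤w i = ≤-trans (u-step i) (u₁≤w i)

    w≤1+u₁ : ∀ i → w i ≤ 1 + u (1 + i)
    w≤1+u₁ i = ≤-trans (w≤1+u i) (s≤s (u-step i))

    w≤1+u₂ : ∀ i → w i ≤ 1 + u (2 + i)
    w≤1+u₂ i = ≤-trans (w≤1+u₁ i) (s≤s (u-step (1 + i)))

    data Gap (i : ℕ) : ℕ → Set where
      one  : Gap i (1 + i)
      more : ∀ {j} → 2 + i ≤ j → Gap i j

    gap : ∀ {i j} → i < j → Gap i j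
    gap i<j with m≤n⇒m<n∨m≡n i<j
    ... | inj₁ 1+i<j = more 1+i<j
    ... | inj₂ refl = one

    φ-mono : ∀ {i j} → i ≤ j → i * φ ≤ j * φ
    φ-mono = *-monoˡ-≤ φ

    Apart : (ℕ → ℕ) → (ℕ → ℕ) → (ℕ → ℕ) → (ℕ → ℕ) → ℕ → ℕ → Set
    Apart A x B y i j = Separated n (φ + e) (A i) (x i) (B j) (y j)

  PP : ∀ {i j} → i < j → Apart P ℓP P ℓP i j
  PP {i} {j} i<j with gap i<j
  ... | one    = fromArith (PP₁ (i * e) (ℓP i) (u i) _ (u-step i) (u-jump i))
  ... | more h = separated-labels {a = P i} {b = P j} (labels₂ (ℓP i) (ℓP j) (φ-mono h))

  QQ : ∀ {i j} → i < j → Apart Q ℓQ Q ℓQ i j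
  QQ {i} {j} i<j with gap i<j
  ... | one    = fromArith (QQ₁ (i * e) (ℓP i) (w i) _ (γ i) (γ (1 + i))
    (w-step i) (w-jump i) (γ-step i) (γ+1≤φ (1 + i)))
  ... | more h = separated-labels {a = Q i} {b = Q j} (≤-trans
    (≤-reflexive (sym (+-assoc (φ + e) (ℓP i) (γ i))))
    (+-mono-≤ (labels₂ (ℓP i) (ℓP j) (φ-mono h)) (step⇒mono γ-step (<⇒≤ i<j))))

  PQ : ∀ {i j} → i ≤ j → Apart P ℓP Q ℓQ i j
  PQ {i} {j} i≤j with m≤n⇒m<n∨m≡n i≤j
  ... | inj₂ refl = fromArith (PQ₀ (i * e) (ℓP i) (u i) (w i) (γ i) (u≤w i) (w≤1+u i) (γ+1≤φ i) (γ-low i))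
  ... | inj₁ i<j with gap i<j
  ...   | one    = fromArith (PQ₁ (i * e) (ℓP i) (u i) (w (1 + i)) (γ (1 + i))
    (≤-trans (u≤w i) (w-step i)) (≤-trans (w-jump i) (s≤s (w≤1+u i))) (γ+1≤φ (1 + i)))
  ...   | more h = separated-labels {a = P i} {b = Q j} (≤-trans
    (labels₂ (ℓP i) (ℓP j) (φ-mono h)) (m≤m+n (ℓP j) (γ j)))

  -- From `Q` to `P` the offset γ i is lost from the label difference, so here positions still
  -- matter at index difference two.
  QP : ∀ {i j} → i < j → Apart Q ℓQ P ℓP i j
  QP {i} {j} i<j with gap i<j
  ... | one = fromArithʳ (QP₁ (i * e) (ℓP i) (u (1 + i)) (w i) (γ i)
    (u₁≤w i) (w≤1+u₁ i) (γ+1≤φ i) (γ-high i))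
  ... | more h with m≤n⇒m<n∨m≡n h
  ...   | inj₂ refl = fromArithʳ (QP₂ (i * e) (ℓP i) (u (2 + i)) (w i) (γ i)
    (u₂≤w i) (w≤1+u₂ i) (γ+1≤φ i) (γ-high i))
  ...   | inj₁ h′ = separated-labels {a = Q i} {b = P j} (labels₃ (ℓP i) (ℓP j) (γ i) (γ+1≤φ i) (φ-mono h′))

-- Distinctness of the listed vertices

linear-≡ : ∀ {l r a b} → a ≡ b → l + b ≡ r + a → l ≡ r
linear-≡ {l} {r} {a} refl eq = +-cancelʳ-≡ a l r eq

-- Congruence modulo n, with multiples of n added on both sides to avoid subtraction.
Cong : ℕ → ℕ → ℕ → Set
Cong n a b = ∃[ s ] ∃[ t ] a + s * n ≡ b + t * n

cong-sym : ∀ {n a b} → Cong n a b → Cong n b a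
cong-sym (s , t , eq) = t , s , sym eq

%≡⇒cong : ∀ {n} .{{_ : NonZero n}} a b → a % n ≡ b % n → Cong n a b
%≡⇒cong {n} a b eq = b / n , a / n ,
  linear-≡ (cong₂ _+_ (m≡m%n+[m/n]*n a n) (trans (cong (_+ (b / n) * n) eq) (sym (m≡m%n+[m/n]*n b n))))
    (arrange a b (a % n) ((a / n) * n) ((b / n) * n))
  where
  arrange : ∀ a b r x y → a + y + (r + x + b) ≡ b + x + (a + (r + y))
  arrange = solve-∀

cong⇒%≡ : ∀ {n} .{{_ : NonZero n}} {a b} → Cong n a b → a % n ≡ b % n
cong⇒%≡ {n} {a} {b} (s , t , eq) =
  trans (sym ([m+kn]%n≡m%n a s n)) (trans (cong (_% n) eq) ([m+kn]%n≡m%n b t n))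

cong-cancel-+ : ∀ {n} x {a b} → Cong n (x + a) (x + b) → Cong n a b
cong-cancel-+ {n} x {a} {b} (s , t , eq) = s , t , +-cancelˡ-≡ x _ _
  (trans (sym (+-assoc x a (s * n))) (trans eq (+-assoc x b (t * n))))

cong-+ : ∀ {n} x {a b} → Cong n a b → Cong n (a + x) (b + x)
cong-+ {n} x {a} {b} (s , t , eq) = s , t ,
  linear-≡ eq (arrange a b x (s * n) (t * n))
  where
  arrange : ∀ a b x s t → a + x + s + (b + t) ≡ b + x + t + (a + s)
  arrange = solve-∀

cong-residue : ∀ {n a b} → a < n → b < n → Cong n a b → a ≡ b
cong-residue {suc n} a<n b<n c = trans (sym (m<n⇒m%n≡m a<n)) (trans (cong⇒%≡ c) (m<n⇒m%n≡m b<n))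

cong-cancel-scale : ∀ {g n a b} .{{_ : NonZero g}} → Cong (g * n) (g * a) (g * b) → Cong n a b
cong-cancel-scale {g} {n} {a} {b} (s , t , eq) = s , t , *-cancelˡ-≡ _ _ g
  (trans (arrange g a s n) (trans eq (sym (arrange g b t n))))
  where
  arrange : ∀ g a s n → g * (a + s * n) ≡ g * a + s * (g * n)
  arrange = solve-∀

-- The congruence says that n divides e (b - a), hence b - a by coprimality.
cong-cancel-≤ : ∀ {n e a b} → Coprime n e → a ≤ b → Cong n (e * a) (e * b) → Cong n a b
cong-cancel-≤ {n} {e} {a} {b} coprime a≤b (s , t , eq) =
  let divides q d≡ = coprime-divisor coprime n∣ed
  in q , 0 , trans (cong (a +_) (sym d≡)) (trans a+d≡b (sym (+-identityʳ b)))
  where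
  d : ℕ
  d = b ∸ a
  a+d≡b : a + d ≡ b
  a+d≡b = m+[n∸m]≡n a≤b
  arrange : ∀ e a d x y → x + (e * (a + d) + y) ≡ y + e * d + (e * a + x)
  arrange = solve-∀
  n∣ed : n ∣ e * d
  n∣ed = ∣m+n∣m⇒∣n (subst (n ∣_)
    (linear-≡ (trans eq (cong (λ b → e * b + t * n) (sym a+d≡b))) (arrange e a d (s * n) (t * n)))
    (n∣m*n s)) (n∣m*n t)

cong-cancel-coprime : ∀ {n e a b} → Coprime n e → Cong n (e * a) (e * b) → Cong n a b
cong-cancel-coprime {n} {e} {a} {b} coprime c with ≤-total a b
... | inj₁ a≤b = cong-cancel-≤ coprime a≤b c
... | inj₂ b≤a = cong-sym (cong-cancel-≤ coprime b≤a (cong-sym c))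

cong-drop : ∀ {n a b} → Cong n a (n + b) → Cong n a b
cong-drop {n} {a} {b} (s , t , eq) = s , 1 + t , trans eq (arrange n b (t * n))
  where
  arrange : ∀ n b t → n + b + t ≡ b + (n + t)
  arrange = solve-∀

module Coset {g N e′ : ℕ} .{{_ : NonZero g}} (coprime : Coprime N e′) where

  cong-shift : ∀ a b x y → Cong (g * N) (a * (g * e′) + x) (b * (g * e′) + y) → Cong g x y
  cong-shift a b x y (s , t , eq) = a * e′ + s * N , b * e′ + t * N ,
    trans (arrange x g a e′ s N) (trans eq (sym (arrange y g b e′ t N)))
    where
    arrange : ∀ x g a e s n → x + (a * e + s * n) * g ≡ a * (g * e) + x + s * (g * n)
    arrange = solve-∀

  cong-step : ∀ a b x → Cong (g * N) (a * (g * e′) + x) (b * (g * e′) + x) → Cong N a b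
  cong-step a b x (s , t , eq) = cong-cancel-coprime coprime (cong-cancel-scale {g} (s , t ,
    linear-≡ eq (arrange g e′ a b x (s * (g * N)) (t * (g * N)))))
    where
    arrange : ∀ g e a b x s t → g * (e * a) + s + (b * (g * e) + x + t) ≡ g * (e * b) + t + (a * (g * e) + x + s)
    arrange = solve-∀

  -- Modulo g N, the element g e′ generates the multiples of g. Reduction modulo g recovers the
  -- coset representative x; cancelling x, g and e′ then recovers a modulo N.
  coset-injective : ∀ a b {x y} → x < g → y < g →
    Cong (g * N) (a * (g * e′) + x) (b * (g * e′) + y) → x ≡ y × Cong N a b
  coset-injective a b {x} {y} x<g y<g c with cong-residue x<g y<g (cong-shift a b x y c)
  ... | refl = refl , cong-step a b x c

quotient-injective : ∀ {N} .{{_ : NonZero N}} {a b} → a / N ≡ b / N → Cong N a b → a ≡ b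
quotient-injective {N} {a} {b} q c = trans (m≡m%n+[m/n]*n a N)
  (trans (cong₂ _+_ (cong⇒%≡ c) (cong (_* N) q)) (sym (m≡m%n+[m/n]*n b N)))

[m+n]/n≡1+m/n : ∀ m n .{{_ : NonZero n}} → (m + n) / n ≡ 1 + m / n
[m+n]/n≡1+m/n m n = trans (m/n≡1+[m∸n]/n (m≤n+m n m)) (cong (λ x → 1 + x / n) (m+n∸n≡m m n))

[m+o]/n≤1+m/n : ∀ m {o} n .{{_ : NonZero n}} → o ≤ n → (m + o) / n ≤ 1 + m / n
[m+o]/n≤1+m/n m n o≤n = ≤-trans (/-monoˡ-≤ n (+-monoʳ-≤ m o≤n)) (≤-reflexive ([m+n]/n≡1+m/n m n))

[1+m]/n≤1+m/n : ∀ m n .{{_ : NonZero n}} → (1 + m) / n ≤ 1 + m / n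
[1+m]/n≤1+m/n m n@(suc _) = ≤-trans (≤-reflexive (cong (_/ n) (+-comm 1 m))) ([m+o]/n≤1+m/n m n (s≤s z≤n))

-- Here n = g N.  The jump D occurs in Q from index M ∸ p on; the condition
-- balance makes the vertices of Q in the shared coset miss those of P.
module OddOrder {h M e′ p γ₀ D φ : ℕ} (coprime : Coprime (1 + 2 * M) e′)
  (1≤M : 1 ≤ M) (p<M : p < M) (e+2≤φ : (1 + 2 * h) * e′ + 2 ≤ φ)
  (low : φ ≤ γ₀ + γ₀ + (1 + 2 * h) * e′)
  (high : γ₀ + D + (γ₀ + D) ≤ φ + (1 + 2 * h) * e′)
  (balance : Cong ((1 + 2 * h) * (1 + 2 * M)) (2 * (γ₀ + 2 * ((1 + 2 * h) * e′)) + 1)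
                  ((1 + 2 * h) + ((1 + 2 * h) * e′) * (1 + 2 * p)))
  (2D≡e⊎0 : 2 * D ≡ (1 + 2 * h) * e′ ⊎ (D ≡ 0 × p ≡ 0)) where

  g N e m : ℕ
  g = 1 + 2 * h
  N = 1 + 2 * M
  e = g * e′
  -- So n = 2 m + 1. The vertices `P` 0, ..., `P` m fill h cosets and M + 1 places of one more; the
  -- m vertices of `Q` take the other M places of that coset and then h full cosets.
  m = h * N + M

  bump : ∀ {i} → Dec (M ≤ i + p) → ℕ
  bump (yes _) = D
  bump (no  _) = 0

  bump≤D : ∀ {i} (d : Dec (M ≤ i + p)) → bump {i} d ≤ D
  bump≤D (yes _) = ≤-refl
  bump≤D (no  _) = z≤n

  bump-step : ∀ {i} (d : Dec (M ≤ i + p)) (d′ : Dec (M ≤ 1 + i + p)) → bump {i} d ≤ bump {1 + i} d′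
  bump-step (no _)  _        = z≤n
  bump-step (yes _) (yes _)  = ≤-refl
  bump-step (yes h) (no ¬h′) = contradiction (m≤n⇒m≤1+n h) ¬h′

  1+M≤N : 1 + M ≤ N
  1+M≤N = s≤s (m≤m+n M _)

  profile : Profile e φ
  profile = record
    { e+2≤φ = e+2≤φ
    ; u = λ i → i / N
    -- The shift by 1 + M makes `Q` leave its first coset after M vertices.
    ; w = λ i → (i + (1 + M)) / N
    ; γ = λ i → γ₀ + bump {i} (M ≤? i + p)
    ; u-step = λ i → /-monoˡ-≤ N (n≤1+n i)
    ; u-jump = λ i → [1+m]/n≤1+m/n i N
    ; w-step = λ i → /-monoˡ-≤ N (n≤1+n (i + (1 + M)))
    ; w-jump = λ i → [1+m]/n≤1+m/n (i + (1 + M)) N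
    ; γ-step = λ i → +-monoʳ-≤ γ₀ (bump-step {i} (M ≤? i + p) (M ≤? 1 + i + p))
    ; u₂≤w = λ i → /-monoˡ-≤ N (≤-trans (≤-reflexive (+-comm 2 i)) (+-monoʳ-≤ i (s≤s 1≤M)))
    ; w≤1+u = λ i → [m+o]/n≤1+m/n i N 1+M≤N
    ; γ-low = λ i → γ-low i (bump {i} (M ≤? i + p)) (/-monoˡ-≤ N (m≤m+n i (1 + M)))
    ; γ-high = λ i → ≤-trans (+-mono-≤ (γ≤ i) (γ≤ i)) high
    }
    where
    γ≤ : ∀ i → γ₀ + bump {i} (M ≤? i + p) ≤ γ₀ + D
    γ≤ i = +-monoʳ-≤ γ₀ (bump≤D {i} (M ≤? i + p))
    γ-low : ∀ i b {u w} → u ≤ w → φ + u ≤ γ₀ + b + (γ₀ + b) + e + w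
    γ-low i b u≤w = +-mono-≤ (≤-trans low (+-monoˡ-≤ e (+-mono-≤ (m≤m+n γ₀ b) (m≤m+n γ₀ b)))) u≤w

  open Profile profile using (P; Q; u; w; γ)

  n : ℕ
  n = g * N

  open Coset {g} {N} {e′} coprime

  u≤h : ∀ {i} → i ≤ m → u i ≤ h
  u≤h {i} i≤m = m<1+n⇒m≤n (m<n*o⇒m/o<n (≤-<-trans i≤m (bound h M)))
    where
    bound : ∀ h M → h * (1 + 2 * M) + M < (1 + h) * (1 + 2 * M)
    bound h M = slack M (solve (h ∷ M ∷ []))

  w≤h : ∀ {i} → i < m → w i ≤ h
  w≤h {i} i<m = m<1+n⇒m≤n (m<n*o⇒m/o<n (bound i h M i<m))
    where
    bound : ∀ i h M → i < h * (1 + 2 * M) + M → i + (1 + M) < (1 + h) * (1 + 2 * M)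
    bound i h M i<m = linear 0 i<m (solve (i ∷ h ∷ M ∷ []))

  2*<g : ∀ {x} → x ≤ h → 2 * x < g
  2*<g x≤h = s≤s (*-monoʳ-≤ 2 x≤h)

  ≤h⇒<g : ∀ {x} → x ≤ h → x < g
  ≤h⇒<g x≤h = s≤s (≤-trans x≤h (m≤m+n h _))

  2*<N : ∀ {x} → x ≤ M → 2 * x < N
  2*<N x≤M = s≤s (*-monoʳ-≤ 2 x≤M)

  1+2*<N : ∀ {x} → x < M → 1 + 2 * x < N
  1+2*<N x<M = s≤s (*-monoʳ-< 2 x<M)

  w≡0⇒<M : ∀ {i} → w i ≡ 0 → i < M
  w≡0⇒<M {i} wi≡0 = bound i M (m/n≡0⇒m<n wi≡0)
    where
    bound : ∀ i M → i + (1 + M) < 1 + 2 * M → i < M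
    bound i M h = linear 0 h (solve (i ∷ M ∷ []))

  <M⇒w≡0 : ∀ {i} → i < M → w i ≡ 0
  <M⇒w≡0 {i} i<M = m<n⇒m/n≡0 (bound i M i<M)
    where
    bound : ∀ i M → i < M → i + (1 + M) < 1 + 2 * M
    bound i M h = linear 0 h (solve (i ∷ M ∷ []))

  P-injective : ∀ {i j} → i ≤ m → j ≤ m → Cong n (P i) (P j) → i ≡ j
  P-injective {i} {j} i≤m j≤m c =
    let u≡ , i~j = coset-injective i j (≤h⇒<g (u≤h i≤m)) (≤h⇒<g (u≤h j≤m)) c
    in quotient-injective u≡ i~j

  Qᵇ : ∀ i → Dec (M ≤ i + p) → ℕ
  Qᵇ i d = γ₀ + bump {i} d + 2 * e + i * e + w i

  Q-same : ∀ {i j} b → i < m → j < m →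
    Cong n (γ₀ + b + 2 * e + i * e + w i) (γ₀ + b + 2 * e + j * e + w j) → i ≡ j
  Q-same {i} {j} b i<m j<m c =
    let w≡ , i~j = coset-injective i j (≤h⇒<g (w≤h i<m)) (≤h⇒<g (w≤h j<m))
          (cong-cancel-+ (γ₀ + b + 2 * e) (subst₂ (Cong n) (+-assoc (γ₀ + b + 2 * e) (i * e) (w i))
             (+-assoc (γ₀ + b + 2 * e) (j * e) (w j)) c))
    in +-cancelʳ-≡ (1 + M) i j (quotient-injective w≡ (cong-+ (1 + M) i~j))

  -- If 2 D = e, doubling turns the jump into one more step e. Equal cosets force w j = w i = 0, and
  -- then 2 i and 1 + 2 j, both below N, would be congruent. If D = p = 0, both vertices follow one
  -- formula, so i = j, although i < M ≤ j.
  Q-bumped : ∀ {i j} → i < m → j < m → i < M → M ≤ j + p →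
    ¬ Cong n (γ₀ + 0 + 2 * e + i * e + w i) (γ₀ + D + 2 * e + j * e + w j)
  Q-bumped {i} {j} i<m j<m i<M M≤j+p c = [ half , none ]′ 2D≡e⊎0
    where
    double : ∀ {n} γ e D i j x y → 2 * D ≡ e →
      Cong n (γ + 0 + 2 * e + i * e + x) (γ + D + 2 * e + j * e + y) →
      Cong n (2 * i * e + 2 * x) ((1 + 2 * j) * e + 2 * y)
    double {n} γ _ D i j x y refl (s , t , eq) = 2 * s , 2 * t ,
      linear-≡ (cong (2 *_) eq) (solve (n ∷ γ ∷ D ∷ i ∷ j ∷ x ∷ y ∷ s ∷ t ∷ []))
    half : ¬ (2 * D ≡ e)
    half 2D≡e = even≢odd i j (cong-residue (2*<N (<⇒≤ i<M)) (1+2*<N (w≡0⇒<M {j} wj≡0)) (proj₂ split))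
      where
      split : 2 * w i ≡ 2 * w j × Cong N (2 * i) (1 + 2 * j)
      split = coset-injective (2 * i) (1 + 2 * j) (2*<g (w≤h i<m)) (2*<g (w≤h j<m))
        (double γ₀ e D i j (w i) (w j) 2D≡e c)
      wj≡0 : w j ≡ 0
      wj≡0 = trans (*-cancelˡ-≡ (w j) (w i) 2 (sym (proj₁ split))) (<M⇒w≡0 i<M)
    none : ¬ (D ≡ 0 × p ≡ 0)
    none (D≡0 , p≡0) = <⇒≢ (<-≤-trans i<M (subst (M ≤_) (trans (cong (j +_) p≡0) (+-identityʳ j)) M≤j+p))
      (Q-same 0 i<m j<m (subst (λ D → Cong n (γ₀ + 0 + 2 * e + i * e + w i) (γ₀ + D + 2 * e + j * e + w j)) D≡0 c))

  Q-injective : ∀ {i j} → i < m → j < m → Cong n (Q i) (Q j) → i ≡ j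
  Q-injective {i} {j} i<m j<m = go (M ≤? i + p) (M ≤? j + p)
    where
    <M : ∀ {i} → ¬ (M ≤ i + p) → i < M
    <M {i} h = ≤-<-trans (m≤m+n i p) (≰⇒> h)
    go : ∀ d d′ → Cong n (Qᵇ i d) (Qᵇ j d′) → i ≡ j
    go (yes _) (yes _) c = Q-same D i<m j<m c
    go (no _)  (no _)  c = Q-same 0 i<m j<m c
    go (no h)  (yes k) c = contradiction c (Q-bumped i<m j<m (<M h) k)
    go (yes k) (no h)  c = contradiction (cong-sym c) (Q-bumped j<m i<m (<M h) k)


  -- Doubling and adding 1 makes `balance` applicable; it replaces the start of `Q` by g plus an odd
  -- multiple of e. The number δ counts the half steps e / 2 in b.
  doubled : ∀ i j δ b → 2 * b ≡ δ * e → Cong n (P i) (γ₀ + b + 2 * e + j * e + w j) →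
    Cong n (2 * i * e + (1 + 2 * u i)) ((1 + 2 * p + δ + 2 * j) * e + (g + 2 * w j))
  doubled i j δ b 2b≡δe c = combine n e g p γ₀ i j (u i) (w j) δ b 2b≡δe c balance
    where
    combine : ∀ n e g p γ i j x y δ b → 2 * b ≡ δ * e →
      Cong n (i * e + x) (γ + b + 2 * e + j * e + y) →
      Cong n (2 * (γ + 2 * e) + 1) (g + e * (1 + 2 * p)) →
      Cong n (2 * i * e + (1 + 2 * x)) ((1 + 2 * p + δ + 2 * j) * e + (g + 2 * y))
    combine n e g p γ i j x y δ b 2b≡ (s , t , eq) (s′ , t′ , eq′) = 2 * s + s′ , 2 * t + t′ ,
      linear-≡ (cong₂ _+_ (cong (2 *_) eq) (cong₂ _+_ eq′ 2b≡))
        (solve (n ∷ e ∷ g ∷ p ∷ γ ∷ i ∷ j ∷ x ∷ y ∷ δ ∷ b ∷ s ∷ t ∷ s′ ∷ t′ ∷ []))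

  -- Modulo g, the doubled congruence compares the odd number 1 + 2 u i with the even number 2 w j,
  -- both below g unless u i = h. In that case 1 + 2 u i = g, which forces w j = 0, and the step
  -- counts remain to be compared modulo N.
  coset-meet : ∀ {i j} δ b → i ≤ m → j < m → 2 * b ≡ δ * e →
    Cong n (P i) (γ₀ + b + 2 * e + j * e + w j) →
    w j ≡ 0 × (∃[ r ] r ≤ M × Cong N (2 * r) (1 + 2 * p + δ + 2 * j))
  coset-meet {i} {j} δ b i≤m j<m 2b≡δe c with m≤n⇒m<n∨m≡n (u≤h i≤m)
  ... | inj₁ ui<h = contradiction
    (cong-residue (2*<g (w≤h j<m)) (s≤s (*-monoʳ-< 2 ui<h)) (cong-sym (cong-drop modulo-g))) (even≢odd (w j) (u i))
    where
    modulo-g : Cong g (1 + 2 * u i) (g + 2 * w j)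
    modulo-g = cong-shift (2 * i) (1 + 2 * p + δ + 2 * j) _ _ (doubled i j δ b 2b≡δe c)
  ... | inj₂ ui≡h = wj≡0 , i % N , r≤M , reduce (cong-step (2 * i) X g
    (subst₂ (λ u x → Cong n (2 * i * e + (1 + 2 * u)) (X * e + x)) ui≡h
      (trans (cong (λ w → g + 2 * w) wj≡0) (+-identityʳ g)) (doubled i j δ b 2b≡δe c)))
    where
    X : ℕ
    X = 1 + 2 * p + δ + 2 * j
    wj≡0 : w j ≡ 0
    wj≡0 = *-cancelˡ-≡ (w j) 0 2 (sym (cong-residue (s≤s z≤n) (2*<g (w≤h j<m)) g~))
      where
      g~ : Cong g 0 (2 * w j)
      g~ = cong-cancel-+ g (subst (λ a → Cong g a (g + 2 * w j))
        (trans (cong (λ u → 1 + 2 * u) ui≡h) (sym (+-identityʳ g)))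
        (cong-shift (2 * i) X _ _ (doubled i j δ b 2b≡δe c)))
    i≡ : i ≡ i % N + h * N
    i≡ = trans (m≡m%n+[m/n]*n i N) (cong (λ u → i % N + u * N) ui≡h)
    r≤M : i % N ≤ M
    r≤M = +-cancelʳ-≤ (h * N) _ _ (≤-trans (≤-reflexive (sym i≡)) (≤-trans i≤m (≤-reflexive (+-comm (h * N) M))))
    reduce : Cong N (2 * i) X → Cong N (2 * (i % N)) X
    reduce (s , t , eq) = 2 * h + s , t ,
      trans (arrange (i % N) h N s) (trans (cong (λ i → 2 * i + s * N) (sym i≡)) eq)
      where
      arrange : ∀ r h N s → 2 * r + (2 * h + s) * N ≡ 2 * (r + h * N) + s * N
      arrange = solve-∀

  -- Counted in half steps, `P` occupies even numbers 2 r < N in the shared coset. Before the jump,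
  -- `Q` occupies odd numbers 1 + 2 (j + p) < N. From j + p = M on, reduction by the odd N would
  -- make them even; the extra half step makes them odd again. If D = p = 0, these j have already
  -- left the coset.
  P≢Q : ∀ {i j} → i ≤ m → j < m → ¬ Cong n (P i) (Q j)
  P≢Q {i} {j} i≤m j<m = go (M ≤? j + p)
    where
    arrange₀ : ∀ p j → 1 + 2 * p + 0 + 2 * j ≡ 1 + 2 * (j + p)
    arrange₀ = solve-∀
    go : ∀ d → ¬ Cong n (P i) (Qᵇ j d)
    go (no h) c =
      let wj≡0 , r , r≤M , r~ = coset-meet 0 0 i≤m j<m refl c
      in even≢odd r (j + p) (cong-residue (2*<N r≤M) (1+2*<N (≰⇒> h)) (subst (Cong N (2 * r)) (arrange₀ p j) r~))
    go (yes h) c = [ half , none ]′ 2D≡e⊎0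
      where
      half : ¬ (2 * D ≡ e)
      half 2D≡e = even≢odd r y (cong-residue (2*<N r≤M) (1+2*<N y<M) (cong-drop (subst (Cong N (2 * r)) X≡ r~)))
        where
        meet : w j ≡ 0 × (∃[ r ] r ≤ M × Cong N (2 * r) (1 + 2 * p + 1 + 2 * j))
        meet = coset-meet 1 D i≤m j<m (trans 2D≡e (sym (+-identityʳ e))) c
        r y : ℕ
        r = proj₁ (proj₂ meet)
        y = j + p ∸ M
        r≤M : r ≤ M
        r≤M = proj₁ (proj₂ (proj₂ meet))
        r~ : Cong N (2 * r) (1 + 2 * p + 1 + 2 * j)
        r~ = proj₂ (proj₂ (proj₂ meet))
        M+y≡ : M + y ≡ j + p
        M+y≡ = m+[n∸m]≡n h
        X≡ : 1 + 2 * p + 1 + 2 * j ≡ N + (1 + 2 * y)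
        X≡ = linear-≡ (cong (2 *_) (sym M+y≡)) (arrange p j M y)
          where
          arrange : ∀ p j M y → 1 + 2 * p + 1 + 2 * j + 2 * (M + y) ≡ 1 + 2 * M + (1 + 2 * y) + 2 * (j + p)
          arrange = solve-∀
        y<M : y < M
        y<M = +-cancelˡ-< M y M (subst (_< M + M) (sym M+y≡) (+-mono-<-≤ (w≡0⇒<M (proj₁ meet)) (<⇒≤ p<M)))
      none : ¬ (D ≡ 0 × p ≡ 0)
      none (D≡0 , p≡0) = <⇒≱ (w≡0⇒<M (proj₁ (coset-meet {i} 0 D i≤m j<m (cong (2 *_) D≡0) c)))
        (subst (M ≤_) (trans (cong (j +_) p≡0) (+-identityʳ j)) h)

-- The labelings

module Realise {e φ c b k s : ℕ} (profile : Profile e φ) .{{_ : NonZero (c + b)}}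
  (n≡ : c + b ≡ φ + 3 * e + 1) (k≡ : φ + e ≡ k + 1) where
  open Profile profile
  open Spacing {n = c + b} profile n≡

  private
    n : ℕ
    n = c + b
    lift label : Fin c ⊎ Fin b → ℕ
    lift  = [ P ∘ toℕ , Q ∘ toℕ ]′
    label = [ ℓP ∘ toℕ , ℓQ ∘ toℕ ]′

    vertex : Fin c ⊎ Fin b → Fin n
    vertex i = lift i mod n

    apart : ∀ i j → i ≢ j → φ + e ≤ ∣ label i - label j ∣ + cycleDist n (vertex i) (vertex j)
    apart (inj₁ i) (inj₁ j) i≢j with <-cmp (toℕ i) (toℕ j)
    ... | tri< i<j _ _ = PP i<j
    ... | tri≈ _ i≡j _ = contradiction (cong inj₁ (toℕ-injective i≡j)) i≢j
    ... | tri> _ _ j<i = separated-sym (P (toℕ j)) (ℓP (toℕ j)) (P (toℕ i)) (ℓP (toℕ i)) (PP j<i)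
    apart (inj₂ i) (inj₂ j) i≢j with <-cmp (toℕ i) (toℕ j)
    ... | tri< i<j _ _ = QQ i<j
    ... | tri≈ _ i≡j _ = contradiction (cong inj₂ (toℕ-injective i≡j)) i≢j
    ... | tri> _ _ j<i = separated-sym (Q (toℕ j)) (ℓQ (toℕ j)) (Q (toℕ i)) (ℓQ (toℕ i)) (QQ j<i)
    apart (inj₁ i) (inj₂ j) _ with ≤-<-connex (toℕ i) (toℕ j)
    ... | inj₁ i≤j = PQ i≤j
    ... | inj₂ j<i = separated-sym (Q (toℕ j)) (ℓQ (toℕ j)) (P (toℕ i)) (ℓP (toℕ i)) (QP j<i)
    apart (inj₂ i) (inj₁ j) _ with ≤-<-connex (toℕ j) (toℕ i)
    ... | inj₁ j≤i = separated-sym (P (toℕ j)) (ℓP (toℕ j)) (Q (toℕ i)) (ℓQ (toℕ i)) (PQ j≤i)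
    ... | inj₂ i<j = QP i<j

    mod-cong : ∀ {a b} → a mod n ≡ b mod n → Cong n a b
    mod-cong {a} {b} eq = %≡⇒cong a b (trans (sym (toℕ-mod a n)) (trans (cong toℕ eq) (toℕ-mod b n)))

  realise :
    (∀ {i j} → i < c → j < c → Cong n (P i) (P j) → i ≡ j) →
    (∀ {i j} → i < b → j < b → Cong n (Q i) (Q j) → i ≡ j) →
    (∀ {i j} → i < c → j < b → ¬ Cong n (P i) (Q j)) →
    (∀ {i} → i < c → ℓP i ≤ s) → (∀ {i} → i < b → ℓQ i ≤ s) → 0 < c →
    (∃[ i ] i < c × ℓP i ≡ s) ⊎ (∃[ i ] i < b × ℓQ i ≡ s) →
    ∃[ f ] IsRadioLabeling n k f × IsSpan n f s
  realise P-inj Q-inj P≢Q P≤ Q≤ 0<c top =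
    transport-labels (vertex ∘ splitAt c) (label ∘ splitAt c)
      (λ {i} {j} eq → splitAt-injective (vertex-injective (splitAt c i) (splitAt c j) eq))
      (λ i j i≢j → ≤-trans (≤-reflexive (sym k≡)) (apart (splitAt c i) (splitAt c j) (i≢j ∘ splitAt-injective)))
      (label≤ ∘ splitAt c)
      (attained (inj₁ (fromℕ< 0<c)) (cong (_* φ) (toℕ-fromℕ< 0<c)))
      ([ (λ (i , i<c , eq) → attained (inj₁ (fromℕ< i<c)) (trans (cong ℓP (toℕ-fromℕ< i<c)) eq))
       , (λ (i , i<b , eq) → attained (inj₂ (fromℕ< i<b)) (trans (cong ℓQ (toℕ-fromℕ< i<b)) eq)) ]′ top)
    where
    splitAt-injective : ∀ {i j} → splitAt c {b} i ≡ splitAt c j → i ≡ j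
    splitAt-injective {i} {j} eq =
      trans (sym (join-splitAt c b i)) (trans (cong (join c b) eq) (join-splitAt c b j))
    vertex-injective : ∀ i j → vertex i ≡ vertex j → i ≡ j
    vertex-injective (inj₁ i) (inj₁ j) eq = cong inj₁ (toℕ-injective (P-inj (toℕ<n i) (toℕ<n j) (mod-cong eq)))
    vertex-injective (inj₂ i) (inj₂ j) eq = cong inj₂ (toℕ-injective (Q-inj (toℕ<n i) (toℕ<n j) (mod-cong eq)))
    vertex-injective (inj₁ i) (inj₂ j) eq = contradiction (mod-cong eq) (P≢Q (toℕ<n i) (toℕ<n j))
    vertex-injective (inj₂ i) (inj₁ j) eq = contradiction (mod-cong (sym eq)) (P≢Q (toℕ<n j) (toℕ<n i))
    label≤ : ∀ i → label i ≤ s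
    label≤ (inj₁ i) = P≤ (toℕ<n i)
    label≤ (inj₂ i) = Q≤ (toℕ<n i)
    attained : ∀ {v} i → label i ≡ v → ∃[ j ] label (splitAt c j) ≡ v
    attained i eq = join c b i , trans (cong label (splitAt-join c b i)) eq

-- Parametrised by e = (n - k - 2) / 2 and w = k - m, where m is n / 2 rounded down; then φ = e + 2
-- + 2 w.
OddCycle : ℕ → ℕ → Set
OddCycle e w = ∃[ f ] IsRadioLabeling (1 + m + m) (2 * e + 1 + 2 * w) f × IsSpan (1 + m + m) f (m * (e + 2 + 2 * w))
  where
  m : ℕ
  m = 2 * e + 1 + w

label-odd : ∀ {h M e′ p γ₀ D w} → let e = (1 + 2 * h) * e′ ; φ = e + 2 + 2 * w in
  Coprime (1 + 2 * M) e′ → 1 ≤ M → p < M →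
  h * (1 + 2 * M) + M ≡ 2 * e + 1 + w →
  φ ≤ γ₀ + γ₀ + e → γ₀ + D + (γ₀ + D) ≤ φ + e →
  Cong ((1 + 2 * h) * (1 + 2 * M)) (2 * (γ₀ + 2 * e) + 1) ((1 + 2 * h) + e * (1 + 2 * p)) →
  (2 * D ≡ e ⊎ (D ≡ 0 × p ≡ 0)) → OddCycle e w
label-odd {h} {M} {e′} {p} {γ₀} {D} {w} coprime 1≤M p<M m≡ low high balance D? =
  Realise.realise {c = 1 + m} {b = m} profile (n≡φ e w) (k≡ e w)
    (λ i<c j<c c → P-injective (≤m i<c) (≤m j<c) (toN c))
    (λ i<b j<b c → Q-injective (<m i<b) (<m j<b) (toN c))
    (λ i<c j<b c → P≢Q (≤m i<c) (<m j<b) (toN c))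
    (λ i<c → *-monoˡ-≤ φ (s≤s⁻¹ i<c))
    -- Since γ i ≤ φ, the label of `Q i` is at most that of `P (1 + i)`, so the last `P` carries the
    -- largest label.
    (λ {i} i<b → ≤-trans (+-monoʳ-≤ (i * φ) (γ≤φ i)) (≤-trans (≤-reflexive (+-comm (i * φ) φ)) (*-monoˡ-≤ φ i<b)))
    (s≤s z≤n)
    (inj₁ (m , ≤-refl , refl))
  where
  e φ m : ℕ
  e = (1 + 2 * h) * e′
  φ = e + 2 + 2 * w
  m = 2 * e + 1 + w
  open OddOrder {h} {M} {e′} {p} {γ₀} {D} {φ} coprime 1≤M p<M (m≤m+n (e + 2) (2 * w)) low high balance D?
    using (profile; P-injective; Q-injective; P≢Q)
  open Profile profile using (γ; γ-high)
  n≡φ : ∀ e w → 1 + (2 * e + 1 + w) + (2 * e + 1 + w) ≡ e + 2 + 2 * w + 3 * e + 1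
  n≡φ = solve-∀
  k≡ : ∀ e w → e + 2 + 2 * w + e ≡ 2 * e + 1 + 2 * w + 1
  k≡ = solve-∀
  n≡ : 1 + m + m ≡ (1 + 2 * h) * (1 + 2 * M)
  n≡ = trans (cong₂ (λ x y → 1 + x + y) (sym m≡) (sym m≡)) (product h M)
    where
    product : ∀ h M → 1 + (h * (1 + 2 * M) + M) + (h * (1 + 2 * M) + M) ≡ (1 + 2 * h) * (1 + 2 * M)
    product = solve-∀
  toN : ∀ {a b} → Cong (1 + m + m) a b → Cong ((1 + 2 * h) * (1 + 2 * M)) a b
  toN {a} {b} = subst (λ n → Cong n a b) n≡
  ≤m : ∀ {i} → i < 1 + m → i ≤ h * (1 + 2 * M) + M
  ≤m (s≤s i≤m) = ≤-trans i≤m (≤-reflexive (sym m≡))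
  <m : ∀ {i} → i < m → i < h * (1 + 2 * M) + M
  <m i<m = ≤-trans i<m (≤-reflexive (sym m≡))
  γ≤φ : ∀ i → γ i ≤ φ
  γ≤φ i = *-cancelˡ-≤ 2 (halve (γ i) φ e (γ-high i) (m≤m+n (e + 2) (2 * w)))
    where
    halve : ∀ g φ e → g + g ≤ φ + e → e + 2 ≤ φ → 2 * g ≤ 2 * φ
    halve g φ e p q = linear 2 (+-mono-≤ p q) (solve (g ∷ φ ∷ e ∷ []))

-- Again e = (n - k - 2) / 2 and w = k - m, with m = n / 2; now φ = e + 3 + 2 w, and the span is the
-- label of the last `Q`.
EvenCycle : ℕ → ℕ → Set
EvenCycle e w = ∃[ f ] IsRadioLabeling (m + m) (2 * e + 2 + 2 * w) f ×
    IsSpan (m + m) f ((2 * e + 1 + w) * (e + 3 + 2 * w) + (1 + w))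
  where
  m : ℕ
  m = 2 * e + 2 + w

module EvenOrder {g N e′ w : ℕ} .{{_ : NonZero g}} (coprime : Coprime N e′) (2≤N : 2 ≤ N)
  (m≡ : g * N ≡ 2 * (g * e′) + 2 + w) where

  e φ m : ℕ
  e = g * e′
  φ = e + 3 + 2 * w
  m = 2 * e + 2 + w
  instance
    N≢0 : NonZero N
    N≢0 = >-nonZero (≤-trans (s≤s z≤n) 2≤N)
  m+m≢0 : NonZero (m + m)
  m+m≢0 = >-nonZero (≤-trans {1} (≤-trans (s≤s z≤n) (≤-trans (m≤n+m 2 (2 * e)) (m≤m+n _ w))) (m≤m+n m m))
  n≡φ : ∀ e w → 2 * e + 2 + w + (2 * e + 2 + w) ≡ e + 3 + 2 * w + 3 * e + 1
  n≡φ = solve-∀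
  k≡ : ∀ e w → e + 3 + 2 * w + e ≡ 2 * e + 2 + 2 * w + 1
  k≡ = solve-∀
  last : ∀ e w → 1 + (2 * e + 1 + w) ≡ 2 * e + 2 + w
  last = solve-∀
  below : ∀ {i} → i < m → i ≤ 2 * e + 1 + w
  below i<m = s≤s⁻¹ (≤-trans i<m (≤-reflexive (sym (last e w))))
  profile : Profile e φ
  profile = record
    { e+2≤φ = slack (1 + 2 * w) (gap e w)
    ; u = λ i → i / N
    ; w = λ i → 1 + i / N
    -- Chosen so that (1 + w) + 2 e + 1 = m, which makes `Q i` the antipode of `P i`.
    ; γ = λ _ → 1 + w
    ; u-step = λ i → /-monoˡ-≤ N (n≤1+n i)
    ; u-jump = λ i → [1+m]/n≤1+m/n i N
    ; w-step = λ i → s≤s (/-monoˡ-≤ N (n≤1+n i))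
    ; w-jump = λ i → s≤s ([1+m]/n≤1+m/n i N)
    ; γ-step = λ _ → ≤-refl
    ; u₂≤w = λ i → ≤-trans (≤-reflexive (cong (_/ N) (+-comm 2 i))) ([m+o]/n≤1+m/n i N 2≤N)
    ; w≤1+u = λ _ → ≤-refl
    ; γ-low = λ i → ≤-reflexive (low e w (i / N))
    ; γ-high = λ _ → slack (2 * e + 1) (high e w)
    }
    where
    gap : ∀ e w → e + 2 + (1 + 2 * w) ≡ e + 3 + 2 * w
    gap = solve-∀
    low : ∀ e w x → e + 3 + 2 * w + x ≡ 1 + w + (1 + w) + e + (1 + x)
    low = solve-∀
    high : ∀ e w → 1 + w + (1 + w) + (2 * e + 1) ≡ e + 3 + 2 * w + e
    high = solve-∀
  open Profile profile using (P; Q)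
  open Coset {g} {N} {e′} coprime
  Q≡ : ∀ i → Q i ≡ m + P i
  Q≡ i = arrange e w (i * e) (i / N)
    where
    arrange : ∀ e w x y → 1 + w + 2 * e + x + (1 + y) ≡ 2 * e + 2 + w + (x + y)
    arrange = solve-∀
  halve : ∀ {a b} → Cong (m + m) a b → Cong m a b
  halve {a} {b} (s , t , eq) = s + s , t + t ,
    trans (arrange a s m) (trans eq (sym (arrange b t m)))
    where
    arrange : ∀ a s m → a + (s + s) * m ≡ a + s * (m + m)
    arrange = solve-∀
  P-injective : ∀ {i j} → i < m → j < m → Cong m (P i) (P j) → i ≡ j
  P-injective {i} {j} i<m j<m c =
    let u≡ , i~j = coset-injective i j (u<g i<m) (u<g j<m) (subst (λ m → Cong m (P i) (P j)) (sym m≡) c)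
    in quotient-injective u≡ i~j
    where
    u<g : ∀ {i} → i < m → i / N < g
    u<g i<m = m<n*o⇒m/o<n (≤-trans i<m (≤-reflexive (sym m≡)))
  -- Modulo m, `Q j` agrees with `P j`, so i = j; but no vertex is its own antipode.
  P≢Q : ∀ {i j} → i < m → j < m → ¬ Cong (m + m) (P i) (Q j)
  P≢Q {i} {j} i<m j<m c = <⇒≢ 0<m (cong-residue 0<m+m m<m+m antipode)
    where
    0<m : 0 < m
    0<m = ≤-trans (s≤s z≤n) i<m
    0<m+m : 0 < m + m
    0<m+m = ≤-trans 0<m (m≤m+n m m)
    m<m+m : m < m + m
    m<m+m = m<m+n m 0<m
    i≡j : i ≡ j
    i≡j = P-injective i<m j<m (cong-drop {m} {P i} {P j} (subst (Cong m (P i)) (Q≡ j) (halve c)))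
    antipode : Cong (m + m) 0 m
    antipode = cong-cancel-+ (P i) {0} {m} (subst₂ (Cong (m + m)) (sym (+-identityʳ (P i)))
      (trans (Q≡ j) (trans (cong (λ j → m + P j) (sym i≡j)) (+-comm m (P i)))) c)

  Q-injective : ∀ {i j} → i < m → j < m → Cong (m + m) (Q i) (Q j) → i ≡ j
  Q-injective {i} {j} i<m j<m c = P-injective i<m j<m
    (cong-cancel-+ m (subst₂ (Cong m) (Q≡ i) (Q≡ j) (halve c)))

  0<m : 0 < m
  0<m = subst (0 <_) (last e w) (s≤s z≤n)

  labeling : EvenCycle e w
  labeling = Realise.realise {c = m} {b = m} {s = (2 * e + 1 + w) * φ + (1 + w)} profile {{m+m≢0}} (n≡φ e w) (k≡ e w)
    (λ {i} {j} i<m j<m c → P-injective {i} {j} i<m j<m (halve c))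
    (λ {i} {j} → Q-injective {i} {j})
    (λ {i} {j} → P≢Q {i} {j})
    (λ {i} i<m → ≤-trans (*-monoˡ-≤ φ (below i<m)) (m≤m+n ((2 * e + 1 + w) * φ) (1 + w)))
    (λ {i} i<m → +-monoˡ-≤ (1 + w) (*-monoˡ-≤ φ (below i<m)))
    0<m
    (inj₂ (2 * e + 1 + w , ≤-reflexive (last e w) , refl))

-- Choice of the parameters

even⊎odd : ∀ n → (∃[ a ] n ≡ 2 * a) ⊎ (∃[ a ] n ≡ 1 + 2 * a)
even⊎odd zero = inj₁ (0 , refl)
even⊎odd (suc n) with even⊎odd n
... | inj₁ (a , refl) = inj₂ (a , refl)
... | inj₂ (a , refl) = inj₁ (1 + a , cong suc (sym (+-suc a (a + 0))))

odd-factorˡ : ∀ a b c → a * b ≡ 1 + 2 * c → ∃[ x ] a ≡ 1 + 2 * x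
odd-factorˡ a b c eq with even⊎odd a
... | inj₁ (x , refl) = contradiction (trans (sym (*-assoc 2 x b)) eq) (even≢odd (x * b) c)
... | inj₂ odd = odd

-- If the inverse of e′ modulo N is even, its negative is odd.
odd-inverse : ∀ {M e′} → 1 ≤ M → Coprime e′ (1 + 2 * M) →
  ∃[ p ] p < M × (Cong (1 + 2 * M) (e′ * (1 + 2 * p)) 1 ⊎ Cong (1 + 2 * M) (e′ * (1 + 2 * p) + 1) 0)
odd-inverse {M} {e′} 1≤M coprime = go (coprime-Bézout coprime)
  where
  N : ℕ
  N = 1 + 2 * M

  residue : ∀ x → x ≡ x % N + x / N * N
  residue x = m≡m%n+[m/n]*n x N

  2*<N⇒<M : ∀ {p} → 1 + 2 * p < N → p < M
  2*<N⇒<M h = *-cancelˡ-< 2 _ _ (s≤s⁻¹ h)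

  nonzero : ∀ {a} → Cong N (e′ * a) 1 ⊎ Cong N (e′ * a + 1) 0 → a ≢ 0
  nonzero c refl rewrite *-zeroʳ e′ = contradiction
    ([ cong-residue (s≤s z≤n) 1<N , sym ∘ cong-residue 1<N (s≤s z≤n) ]′ c) 0≢1+n
    where
    1<N : 1 < N
    1<N = s≤s (≤-trans 1≤M (m≤m+n M _))

  flip : ∀ a b → a + b ≡ N →
    Cong N (e′ * a) 1 ⊎ Cong N (e′ * a + 1) 0 → Cong N (e′ * b) 1 ⊎ Cong N (e′ * b + 1) 0
  flip a b a+b≡N (inj₁ (s , t , eq)) = inj₂ (t , e′ + s , linear-≡
    (cong₂ _+_ (sym eq) (cong (e′ *_) a+b≡N)) (arrange e′ a b s t N))
    where
    arrange : ∀ e a b s t N → e * b + 1 + t * N + (e * a + s * N + e * N) ≡ 0 + (e + s) * N + (1 + t * N + e * (a + b))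
    arrange = solve-∀
  flip a b a+b≡N (inj₂ (s , t , eq)) = inj₁ (t , e′ + s , linear-≡
    (cong₂ _+_ (sym eq) (cong (e′ *_) a+b≡N)) (arrange e′ a b s t N))
    where
    arrange : ∀ e a b s t N → e * b + t * N + (e * a + 1 + s * N + e * N) ≡ 1 + (e + s) * N + (0 + t * N + e * (a + b))
    arrange = solve-∀

  odd-residue : ∀ a → a < N → Cong N (e′ * a) 1 ⊎ Cong N (e′ * a + 1) 0 →
    ∃[ p ] p < M × (Cong N (e′ * (1 + 2 * p)) 1 ⊎ Cong N (e′ * (1 + 2 * p) + 1) 0)
  odd-residue a a<N c with even⊎odd a
  ... | inj₂ (p , refl) = p , 2*<N⇒<M a<N , c
  ... | inj₁ (zero , refl) = contradiction refl (nonzero c)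
  ... | inj₁ (suc b , refl) = M ∸ suc b , ∸-monoʳ-< (s≤s z≤n) b<M , flip (2 * suc b) (1 + 2 * (M ∸ suc b)) total c
    where
    b<M : suc b ≤ M
    b<M = *-cancelˡ-≤ 2 (s≤s⁻¹ a<N)
    total : 2 * suc b + (1 + 2 * (M ∸ suc b)) ≡ N
    total = trans (arrange (suc b) (M ∸ suc b)) (cong (λ M → 1 + 2 * M) (m+[n∸m]≡n b<M))
      where
      arrange : ∀ x y → 2 * x + (1 + 2 * y) ≡ 1 + 2 * (x + y)
      arrange = solve-∀

  go : Bézout.Identity 1 e′ N → _
  go (Bézout.+- x y eq) = odd-residue (x % N) (m%n<n x N) (inj₁ (e′ * (x / N) , y ,
    trans (arrange e′ (x % N) (x / N) N) (trans (cong (_* e′) (sym (residue x))) (sym eq))))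
    where
    arrange : ∀ e r q N → e * r + e * q * N ≡ (r + q * N) * e
    arrange = solve-∀
  go (Bézout.-+ x y eq) = odd-residue (x % N) (m%n<n x N) (inj₂ (e′ * (x / N) , y ,
    trans (arrange e′ (x % N) (x / N) N) (trans (cong (λ x → 1 + x * e′) (sym (residue x))) eq)))
    where
    arrange : ∀ e r q N → e * r + 1 + e * q * N ≡ 1 + (r + q * N) * e
    arrange = solve-∀

cong-scale : ∀ {n a b} g → Cong n a b → Cong (g * n) (g * a) (g * b)
cong-scale {n} {a} {b} g (s , t , eq) = s , t ,
  trans (arrange g a s n) (trans (cong (g *_) eq) (sym (arrange g b t n)))
  where
  arrange : ∀ g a s n → g * a + s * (g * n) ≡ g * (a + s * n)
  arrange = solve-∀

module OddLabeling {h M e′ w : ℕ} (coprime : Coprime (1 + 2 * M) e′) (1≤M : 1 ≤ M)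
  (m≡ : h * (1 + 2 * M) + M ≡ 2 * ((1 + 2 * h) * e′) + 1 + w) where

  g N e : ℕ
  g = 1 + 2 * h
  N = 1 + 2 * M
  e = g * e′

  gN≡ : g * N ≡ 1 + 2 * (2 * e + 1 + w)
  gN≡ = trans (product h M) (cong (λ m → 1 + 2 * m) m≡)
    where
    product : ∀ h M → (1 + 2 * h) * (1 + 2 * M) ≡ 1 + 2 * (h * (1 + 2 * M) + M)
    product = solve-∀

  -- Without a jump, `balance` reads 2 γ₀ + 4 e + 1 ≡ g + e. As n = 4 e + 3 + 2 w, adding n once on
  -- the right gives γ₀ = (g + e) / 2 + 1 + w, an integer since g and e are odd. The upper bound on
  -- γ₀ becomes g ≤ e.
  odd-gap : ∀ a → e ≡ 1 + 2 * a → OddCycle e w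
  odd-gap a e≡ = label-odd {h} {M} {e′} {0} {2 + w + h + a} {0} {w} coprime 1≤M 1≤M m≡
    (low e w h a) (high h a e w h≤a e≡) (0 , 1 , balance a e w h (g * N) e≡ gN≡) (inj₂ (refl , refl))
    where
    instance
      e′≢0 : NonZero e′
      e′≢0 = ≢-nonZero (λ e′≡0 → 0≢1+n (trans (sym (*-zeroʳ g)) (trans (cong (g *_) (sym e′≡0)) e≡)))
    h≤a : h ≤ a
    h≤a = *-cancelˡ-≤ 2 (s≤s⁻¹ (≤-trans (m≤m*n g e′) (≤-reflexive e≡)))
    low : ∀ e w h a → e + 2 + 2 * w ≤ 2 + w + h + a + (2 + w + h + a) + e
    low e w h a = slack (2 + 2 * h + 2 * a) (solve (e ∷ w ∷ h ∷ a ∷ []))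
    high : ∀ h a e w → h ≤ a → e ≡ 1 + 2 * a →
      2 + w + h + a + 0 + (2 + w + h + a + 0) ≤ e + 2 + 2 * w + e
    high h a _ w h≤a refl = linear 0 (+-mono-≤ h≤a h≤a) (solve (h ∷ a ∷ w ∷ []))
    balance : ∀ a e w h n → e ≡ 1 + 2 * a → n ≡ 1 + 2 * (2 * e + 1 + w) →
      2 * (2 + w + h + a + 2 * e) + 1 + 0 * n ≡ 1 + 2 * h + e * (1 + 2 * 0) + 1 * n
    balance a _ w h _ refl refl = solve (a ∷ w ∷ h ∷ [])

  -- The jump is D = a = e / 2. Scaling `odd-inverse` by g gives e (1 + 2 p) ≡ ± g modulo n, so
  -- `balance` asks for 2 γ₀ + 4 e + 1 ≡ 2 g or 0, solved by γ₀ = 1 + w + g or 1 + w. The first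
  -- choice needs g ≤ a: g is odd, so e′ is even and a is a positive multiple of g.
  even-gap : ∀ a → 1 ≤ a → e ≡ 2 * a → OddCycle e w
  even-gap a 1≤a e≡2a = choose (odd-inverse {M} {e′} 1≤M (Coprimality.sym coprime))
    where
    b : ∃[ b ] e′ ≡ 2 * b
    b with even⊎odd e′
    ... | inj₁ b = b
    ... | inj₂ (y , refl) = contradiction (trans (sym e≡2a) (product h y)) (even≢odd a (h + y + 2 * h * y))
      where
      product : ∀ h y → (1 + 2 * h) * (1 + 2 * y) ≡ 1 + 2 * (h + y + 2 * h * y)
      product = solve-∀
    a≡ : a ≡ g * proj₁ b
    a≡ = *-cancelˡ-≡ a (g * proj₁ b) 2 (trans (sym e≡2a) (trans (cong (g *_) (proj₂ b)) (swap g (proj₁ b))))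
      where
      swap : ∀ g b → g * (2 * b) ≡ 2 * (g * b)
      swap = solve-∀
    g≤a : g ≤ a
    g≤a = ≤-trans (m≤m*n g (proj₁ b) {{b≢0}}) (≤-reflexive (sym a≡))
      where
      b≢0 : NonZero (proj₁ b)
      b≢0 = ≢-nonZero (λ b≡0 → <⇒≢ 1≤a (sym (trans a≡ (trans (cong (g *_) b≡0) (*-zeroʳ g)))))

    low₊ : ∀ e w g → e + 2 + 2 * w ≤ 1 + w + g + (1 + w + g) + e
    low₊ e w g = slack (2 * g) (solve (e ∷ w ∷ g ∷ []))
    high₊ : ∀ g a e w → g ≤ a → e ≡ 2 * a → 1 + w + g + a + (1 + w + g + a) ≤ e + 2 + 2 * w + e
    high₊ g a e w g≤a refl = linear 0 (+-mono-≤ g≤a g≤a) (solve (g ∷ a ∷ w ∷ []))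
    balance₊ : ∀ n g e′ w X → n ≡ 1 + 2 * (2 * (g * e′) + 1 + w) → Cong n (g * (e′ * X)) (g * 1) →
      Cong n (2 * (1 + w + g + 2 * (g * e′)) + 1) (g + g * e′ * X)
    balance₊ n g e′ w X n≡ (s , t , eq) = t , 1 + s ,
      linear-≡ (cong₂ _+_ (sym n≡) (sym eq)) (solve (n ∷ g ∷ e′ ∷ w ∷ X ∷ s ∷ t ∷ []))

    low₋ : ∀ e w → e + 2 + 2 * w ≡ 1 + w + (1 + w) + e
    low₋ = solve-∀
    high₋ : ∀ a e w → e ≡ 2 * a → 1 + w + a + (1 + w + a) ≤ e + 2 + 2 * w + e
    high₋ a e w refl = slack (2 * a) (solve (a ∷ w ∷ []))
    balance₋ : ∀ n g e′ w X → n ≡ 1 + 2 * (2 * (g * e′) + 1 + w) → Cong n (g * (e′ * X + 1)) (g * 0) →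
      Cong n (2 * (1 + w + 2 * (g * e′)) + 1) (g + g * e′ * X)
    balance₋ n g e′ w X n≡ (s , t , eq) = t , 1 + s ,
      linear-≡ (cong₂ _+_ (sym n≡) (sym eq)) (solve (n ∷ g ∷ e′ ∷ w ∷ X ∷ s ∷ t ∷ []))

    choose : (∃[ p ] p < M × (Cong N (e′ * (1 + 2 * p)) 1 ⊎ Cong N (e′ * (1 + 2 * p) + 1) 0)) → OddCycle e w
    choose (p , p<M , inj₁ c) = label-odd {h} {M} {e′} {p} {1 + w + g} {a} {w} coprime 1≤M p<M m≡
      (low₊ e w g) (high₊ g a e w g≤a e≡2a)
      (balance₊ (g * N) g e′ w (1 + 2 * p) gN≡ (cong-scale g c)) (inj₁ (sym e≡2a))
    choose (p , p<M , inj₂ c) = label-odd {h} {M} {e′} {p} {1 + w} {a} {w} coprime 1≤M p<M m≡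
      (≤-reflexive (low₋ e w)) (high₋ a e w e≡2a)
      (balance₋ (g * N) g e′ w (1 + 2 * p) gN≡ (cong-scale g c)) (inj₁ (sym e≡2a))

record CoprimeParts (a b : ℕ) : Set where
  constructor parts
  field
    {g a′ b′} : ℕ
    a≡      : a ≡ g * a′
    b≡      : b ≡ g * b′
    coprime : Coprime b′ a′
    g≢0     : NonZero g
    g≤a     : g ≤ a

coprime-parts : ∀ a b → 1 ≤ a → CoprimeParts a b
coprime-parts a b 1≤a = parts (sym (g*[x/g]≡x (gcd[m,n]∣m a b))) (sym (g*[x/g]≡x (gcd[m,n]∣n a b)))
    (Coprimality.sym (coprime-/gcd a b)) g≢0 (∣⇒≤ (gcd[m,n]∣m a b))
  where
  instance
    a≢0 : NonZero a
    a≢0 = >-nonZero 1≤a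
    g≢0 : NonZero (gcd a b)
    g≢0 = ≢-nonZero (gcd[m,n]≢0 a b (inj₁ (m<n⇒n≢0 1≤a)))
  g*[x/g]≡x : ∀ {x} → gcd a b ∣ x → gcd a b * (x / gcd a b) ≡ x
  g*[x/g]≡x g∣x = trans (*-comm (gcd a b) _) (m/n*n≡m g∣x)

-- Take g = gcd(e, n). As n = g N is odd, so are g and N; N = 1 would give n = g ≤ e < n.
odd-labeling : ∀ e w → 1 ≤ e → OddCycle e w
odd-labeling e w 1≤e with coprime-parts e (1 + 2 * (2 * e + 1 + w)) 1≤e
... | parts {g} {e′} {N} refl n≡ coprime _ g≤e
    with odd-factorˡ g N (2 * (g * e′) + 1 + w) (sym n≡) | odd-factorˡ N g (2 * (g * e′) + 1 + w) (trans (*-comm N g) (sym n≡))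
...   | h , refl | M , refl =
    [ (λ (a , e≡) → even-gap a (half a e≡) e≡) , (λ (a , e≡) → odd-gap a e≡) ]′ (even⊎odd (g * e′))
  where
  half : ∀ a → g * e′ ≡ 2 * a → 1 ≤ a
  half zero e≡0 = contradiction (sym e≡0) (<⇒≢ 1≤e)
  half (suc a) _ = s≤s z≤n
  e<n : ∀ e w → e < 1 + 2 * (2 * e + 1 + w)
  e<n e w = slack (3 * e + 2 + 2 * w) (solve (e ∷ w ∷ []))
  1≤M : 1 ≤ M
  1≤M = n≢0⇒n>0 (λ M≡0 → <⇒≱ (e<n (g * e′) w) (≤-trans (≤-reflexive
    (trans n≡ (trans (cong (λ M → g * (1 + 2 * M)) M≡0) (*-identityʳ g)))) g≤e))
  m≡ : h * (1 + 2 * M) + M ≡ 2 * (g * e′) + 1 + w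
  m≡ = *-cancelˡ-≡ _ _ 2 (suc-injective (trans (product h M) (sym n≡)))
    where
    product : ∀ h M → 1 + 2 * (h * (1 + 2 * M) + M) ≡ (1 + 2 * h) * (1 + 2 * M)
    product = solve-∀
  open OddLabeling {h} {M} {e′} {w} coprime 1≤M m≡ using (even-gap; odd-gap)

-- Take g = gcd(e, n / 2), since distinctness within `P` is decided modulo n / 2.
even-labeling : ∀ e w → 1 ≤ e → EvenCycle e w
even-labeling e w 1≤e with coprime-parts e (2 * e + 2 + w) 1≤e
... | parts {g} {e′} {N} refl m≡ coprime g≢0 g≤e = EvenOrder.labeling {g} {N} {e′} {w} {{g≢0}} coprime (2≤ N m≡) (sym m≡)
  where
  e<m : ∀ e w → e < 2 * e + 2 + w
  e<m e w = slack (e + 1 + w) (solve (e ∷ w ∷ []))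
  2≤ : ∀ N → 2 * (g * e′) + 2 + w ≡ g * N → 2 ≤ N
  2≤ zero eq = contradiction (trans eq (*-zeroʳ g)) (m<n⇒n≢0 (e<m (g * e′) w))
  2≤ (suc zero) eq = contradiction (≤-trans (≤-reflexive (trans eq (*-identityʳ g))) g≤e) (<⇒≱ (e<m (g * e′) w))
  2≤ (suc (suc _)) _ = s≤s (s≤s z≤n)

-- Evaluation of the bound and the theorem

[2*a]/2≡a : ∀ a → (2 * a) / 2 ≡ a
[2*a]/2≡a a = trans (cong (_/ 2) (*-comm 2 a)) (m*n/n≡m a 2)

[2*a]%2≡0 : ∀ a → (2 * a) % 2 ≡ 0
[2*a]%2≡0 a = trans (cong (_% 2) (*-comm 2 a)) (m*n%n≡0 a 2)

[1+2*a]%2≡1 : ∀ a → (1 + 2 * a) % 2 ≡ 1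
[1+2*a]%2≡1 a = trans (cong (λ x → (1 + x) % 2) (*-comm 2 a)) ([m+kn]%n≡m%n 1 a 2)

a+a≡2*a : ∀ a → a + a ≡ 2 * a
a+a≡2*a = solve-∀

[a+a]/2≡a : ∀ a → (a + a) / 2 ≡ a
[a+a]/2≡a a = trans (cong (_/ 2) (a+a≡2*a a)) ([2*a]/2≡a a)

LB-%2≡0 : ∀ n k → n % 2 ≡ 0 → LB n k ≡ Φ n k * ((n ∸ 2) / 2) + (k ∸ n / 2) + 1
LB-%2≡0 n k eq with n % 2
... | zero = refl

LB-%2≡1 : ∀ n k → n % 2 ≡ 1 → LB n k ≡ Φ n k * ((n ∸ 1) / 2)
LB-%2≡1 n k eq with n % 2
... | suc _ = refl

-- For n and k of the same parity, r = 3 k + 3 - n is odd, so rounding r / 2 up gives (r + 1) / 2.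
Φ-from-excess : ∀ {n k} φ r → 3 * k + 3 ≡ n + r → r + 1 ≡ φ + φ → Φ n k ≡ φ
Φ-from-excess {n} φ r 3k+3≡ r+1≡ = trans (cong (λ x → (x + 1) / 2) (trans (cong (_∸ n) 3k+3≡) (m+n∸m≡n n r)))
  (trans (cong (_/ 2) r+1≡) ([a+a]/2≡a φ))

odd-radioNumber : ∀ e w → 1 ≤ e → let m = 2 * e + 1 + w ; n = 1 + m + m ; k = 2 * e + 1 + 2 * w in
  IsRadioNumber n k (LB n k)
odd-radioNumber e w 1≤e = subst (IsRadioNumber n k) (sym LB≡)
  ( odd-labeling e w 1≤e
  , λ f s radio (span , _) → subst (_≤ s) (reorder e w)
      -- Here the window parameter is Φ - 1, for which 2 (Φ - 1) + n + 1 = 3 (k + 1) exactly.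
      (Counting.span-odd {n} {k} {f} radio {e + 1 + 2 * w} (≤-reflexive (narrow e w)) m Fin.zero (n≡ m) span) )
  where
  m n k : ℕ
  m = 2 * e + 1 + w
  n = 1 + m + m
  k = 2 * e + 1 + 2 * w
  excess : ∀ e w → 3 * (2 * e + 1 + 2 * w) + 3 ≡ 1 + (2 * e + 1 + w) + (2 * e + 1 + w) + (2 * e + 3 + 4 * w)
  excess = solve-∀
  half : ∀ e w → 2 * e + 3 + 4 * w + 1 ≡ e + 2 + 2 * w + (e + 2 + 2 * w)
  half = solve-∀
  narrow : ∀ e w → 1 + (e + 1 + 2 * w + (e + 1 + 2 * w) + (1 + (2 * e + 1 + w) + (2 * e + 1 + w))) ≡ 3 * (2 * e + 1 + 2 * w + 1)
  narrow = solve-∀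
  reorder : ∀ e w → (1 + (e + 1 + 2 * w)) * (2 * e + 1 + w) ≡ (2 * e + 1 + w) * (e + 2 + 2 * w)
  reorder = solve-∀
  n≡ : ∀ m → 1 + m + m ≡ m + m + 1
  n≡ = solve-∀
  LB≡ : LB n k ≡ m * (e + 2 + 2 * w)
  LB≡ = trans (LB-%2≡1 n k (trans (cong (λ x → (1 + x) % 2) (a+a≡2*a m)) ([1+2*a]%2≡1 m))) (trans
    (cong₂ _*_ (Φ-from-excess {n} {k} (e + 2 + 2 * w) (2 * e + 3 + 4 * w) (excess e w) (half e w)) ([a+a]/2≡a m))
    (*-comm (e + 2 + 2 * w) m))

even-radioNumber : ∀ e w → 1 ≤ e → let m = 2 * e + 2 + w ; n = m + m ; k = 2 * e + 2 + 2 * w in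
  IsRadioNumber n k (LB n k)
even-radioNumber e w 1≤e = subst (IsRadioNumber n k) (sym LB≡)
  ( even-labeling e w 1≤e
  , λ f s radio (span , _) → subst (_≤ s) span≡
      (Counting.span-even {n} {k} {f} radio {e + 2 + 2 * w} (≤-reflexive (narrow e w)) m′
        (fromℕ< {0} (<-≤-trans z<s (≤-trans (m≤n+m 2 (m′ + m′)) (≤-reflexive (sym (n≡ e w)))))) (n≡ e w) (slack w (m′<k e w)) span) )
  where
  m m′ n k : ℕ
  m = 2 * e + 2 + w
  m′ = 2 * e + 1 + w
  n = m + m
  k = 2 * e + 2 + 2 * w
  excess : ∀ e w → 3 * (2 * e + 2 + 2 * w) + 3 ≡ 2 * e + 2 + w + (2 * e + 2 + w) + (2 * e + 5 + 4 * w)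
  excess = solve-∀
  half : ∀ e w → 2 * e + 5 + 4 * w + 1 ≡ e + 3 + 2 * w + (e + 3 + 2 * w)
  half = solve-∀
  narrow : ∀ e w → 1 + (e + 2 + 2 * w + (e + 2 + 2 * w) + (2 * e + 2 + w + (2 * e + 2 + w))) ≡ 3 * (2 * e + 2 + 2 * w + 1)
  narrow = solve-∀
  n≡ : ∀ e w → 2 * e + 2 + w + (2 * e + 2 + w) ≡ 2 * e + 1 + w + (2 * e + 1 + w) + 2
  n≡ = solve-∀
  m′<k : ∀ e w → 1 + (2 * e + 1 + w) + w ≡ 2 * e + 2 + 2 * w
  m′<k = solve-∀
  1+m′≡m : ∀ e w → 1 + (2 * e + 1 + w) ≡ 2 * e + 2 + w
  1+m′≡m = solve-∀
  k≡m+w : ∀ e w → 2 * e + 2 + 2 * w ≡ 2 * e + 2 + w + w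
  k≡m+w = solve-∀
  reorder : ∀ φ m w → φ * m + w + 1 ≡ m * φ + (1 + w)
  reorder = solve-∀
  k∸m≡w : k ∸ m ≡ w
  k∸m≡w = trans (cong (_∸ m) (k≡m+w e w)) (m+n∸m≡n m w)
  span≡ : (1 + (e + 2 + 2 * w)) * m′ + (k ∸ suc m′) + 1 ≡ m′ * (e + 3 + 2 * w) + (1 + w)
  span≡ = trans (cong₂ (λ φ x → φ * m′ + x + 1) (1+φ e w) (trans (cong (k ∸_) (1+m′≡m e w)) k∸m≡w))
    (reorder (e + 3 + 2 * w) m′ w)
    where
    1+φ : ∀ e w → 1 + (e + 2 + 2 * w) ≡ e + 3 + 2 * w
    1+φ = solve-∀
  LB≡ : LB n k ≡ m′ * (e + 3 + 2 * w) + (1 + w)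
  LB≡ = trans (LB-%2≡0 n k (trans (cong (_% 2) (a+a≡2*a m)) ([2*a]%2≡0 m))) (trans
    (cong₂ (λ x y → x + y + 1)
      (cong₂ _*_ (Φ-from-excess {n} {k} (e + 3 + 2 * w) (2 * e + 5 + 4 * w) (excess e w) (half e w))
        (trans (cong (_/ 2) (trans (cong (_∸ 2) (n≡ e w)) (m+n∸n≡m (m′ + m′) 2))) ([a+a]/2≡a m′)))
      (trans (cong (k ∸_) ([a+a]/2≡a m)) k∸m≡w))
    (reorder (e + 3 + 2 * w) m′ w))

∃-excess : ∀ {a b} → a ≤ b → ∃[ d ] b ≡ a + d
∃-excess {a} {b} a≤b = b ∸ a , sym (m+[n∸m]≡n a≤b)

-- By parity, n - k ≥ 3 improves to n - k ≥ 4, which is e ≥ 1.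
κ+2≤m : ∀ {κ m} → 2 * κ + 3 ≤ 2 * m → κ + 2 ≤ m
κ+2≤m {κ} {m} h = ≤-trans (≤-reflexive (+-comm κ 2))
  (*-cancelˡ-< 2 (1 + κ) m (≤-trans (≤-reflexive (arrange κ)) h))
  where
  arrange : ∀ κ → 1 + 2 * (1 + κ) ≡ 2 * κ + 3
  arrange = solve-∀

even-case : ∀ m κ → 2 * κ + 3 ≤ 2 * m → m ≤ 2 * κ → IsRadioNumber (2 * m) (2 * κ) (LB (2 * m) (2 * κ))
even-case m κ k+3≤n m≤k with ∃-excess (κ+2≤m {κ} {m} k+3≤n)
-- From m = κ + 2 + d one gets e = 1 + d; the next excess is w = k - m.
... | d , refl with ∃-excess (bound κ d m≤k)
  where
  bound : ∀ κ d → κ + 2 + d ≤ 2 * κ → d + 2 ≤ κ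
  bound κ d h = linear 0 h (solve (κ ∷ d ∷ []))
... | w , refl = subst₂ (λ n k → IsRadioNumber n k (LB n k)) (n≡ d w) (k≡ d w) (even-radioNumber (1 + d) w (s≤s z≤n))
  where
  n≡ : ∀ d w → 2 * (1 + d) + 2 + w + (2 * (1 + d) + 2 + w) ≡ 2 * (d + 2 + w + 2 + d)
  n≡ = solve-∀
  k≡ : ∀ d w → 2 * (1 + d) + 2 + 2 * w ≡ 2 * (d + 2 + w)
  k≡ = solve-∀

odd-case : ∀ m κ → 2 * κ + 3 ≤ 2 * m → m ≤ 1 + 2 * κ →
  IsRadioNumber (1 + 2 * m) (1 + 2 * κ) (LB (1 + 2 * m) (1 + 2 * κ))
odd-case m κ k+3≤n m≤k with ∃-excess (κ+2≤m {κ} {m} k+3≤n)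
... | d , refl with ∃-excess (bound κ d m≤k)
  where
  bound : ∀ κ d → κ + 2 + d ≤ 1 + 2 * κ → d + 1 ≤ κ
  bound κ d h = linear 0 h (solve (κ ∷ d ∷ []))
... | w , refl = subst₂ (λ n k → IsRadioNumber n k (LB n k)) (n≡ d w) (k≡ d w) (odd-radioNumber (1 + d) w (s≤s z≤n))
  where
  n≡ : ∀ d w → 1 + (2 * (1 + d) + 1 + w) + (2 * (1 + d) + 1 + w) ≡ 1 + 2 * (d + 1 + w + 2 + d)
  n≡ = solve-∀
  k≡ : ∀ d w → 2 * (1 + d) + 1 + 2 * w ≡ 1 + 2 * (d + 1 + w)
  k≡ = solve-∀

theorem3p4 : (n k : ℕ) → 3 ≤ n → n % 2 ≡ k % 2 → n / 2 ≤ k → k ≤ n ∸ 3 →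
    IsRadioNumber n k (LB n k)
theorem3p4 n k 3≤n n≡k n/2≤k k≤n∸3 with even⊎odd n | even⊎odd k
... | inj₁ (m , refl) | inj₂ (κ , refl) =
  contradiction (trans (sym ([2*a]%2≡0 m)) (trans n≡k ([1+2*a]%2≡1 κ))) 0≢1+n
... | inj₂ (m , refl) | inj₁ (κ , refl) =
  contradiction (trans (sym ([2*a]%2≡0 κ)) (trans (sym n≡k) ([1+2*a]%2≡1 m))) 0≢1+n
... | inj₁ (m , refl) | inj₁ (κ , refl) = even-case m κ (m≤o∸n⇒m+n≤o (2 * κ) 3≤n k≤n∸3)
  (≤-trans (≤-reflexive (sym ([2*a]/2≡a m))) n/2≤k)
... | inj₂ (m , refl) | inj₂ (κ , refl) = odd-case m κ (s≤s⁻¹ (m≤o∸n⇒m+n≤o (1 + 2 * κ) 3≤n k≤n∸3))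
  (≤-trans (≤-reflexive (sym ([2*a]/2≡a m))) (≤-trans (/-monoˡ-≤ 2 (n≤1+n (2 * m))) n/2≤k))
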